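{- Let $\vdash$ be an algebraizable logic with equivalent algebraic semantics the quasivariety $\mathbf{Y}$, and let $f$ be a selector term. The map $\mathsf{QVar}^f$ is a dual isomorphism between the complete lattices $\Lambda^f(\vdash)$ and $\Xi^f(\mathbf{Y})$.
   Context: Let $\mathcal{L}$ be an algebraic language, $\mathsf{Prop}$ a fixed countably infinite set of variables, $Tm(\mathcal{L},\mathsf{Prop})$ the set of terms (formulas). A consequence relation on a set $C$ is a relation between subsets and elements of $C$ that is reflexive ($W\vdash a$ if $a\in W$) and satisfies cut (if $W\vdash v$ for all $v\in V$ and $V\vdash a$ then $W\vdash a$); all consequence relations are assumed finitary (if $W\vdash a$ then $V\vdash a$ for some finite $V\subseteq W$). A logic is a substitution-invariant consequence relation on $Tm(\mathcal{L},\mathsf{Prop})$. $\Lambda(\vdash)$ is the complete lattice of (finitary) logics extending $\vdash$. A quasivariety is a class of algebras closed under isomorphisms, subalgebras and reduced products; $\Xi(\mathbf{Y})$ is the lattice of subquasivarieties of $\mathbf{Y}$. For a class $\mathbf{K}$, $\Theta\vDash_{\mathbf{K}}\gamma\approx\delta$ means that every assignment into an algebra of $\mathbf{K}$ satisfying all equations in $\Theta$ satisfies $\gamma\approx\delta$. The logic $\vdash$ is algebraizable with equivalent algebraic semantics the quasivariety $\mathbf{Y}$ (of language $\mathcal{L}$), witnessed by a finite set $\mu(x)$ of equations in one variable and a finite set $\Delta(x,y)$ of formulas in two variables: (1) $\Gamma\vdash\phi$ iff $\mu[\Gamma]\vDash_{\mathbf{Y}}\mu(\phi)$; (2) $\Theta\vDash_{\mathbf{Y}}\gamma\approx\delta$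 iff $\Delta[\Theta]\vdash\Delta(\gamma,\delta)$; (3) $\phi\dashv\vdash\Delta[\mu(\phi)]$; (4) $\gamma\approx\delta$ and $\mu[\Delta(\gamma,\delta)]$ are $\vDash_{\mathbf{Y}}$-interderivable. Here $\mu[\Gamma]$ is the union of the sets $\mu(\psi)$ for $\psi\in\Gamma$, and $\Delta[\Theta]$ is the union of the sets $\Delta(\varepsilon,\upsilon)$ for $\varepsilon\approx\upsilon$ in $\Theta$. A unary term $f(x)$ of $\mathcal{L}$ is a selector term if it is idempotent, i.e. $f(f(x))\dashv\vdash f(x)$ (each of $f(f(x))$ and $f(x)$ is derivable from the other in $\vdash$). $\chi[f(\overline p)/\overline p]$ is the result of substituting $f(q)$ for each variable $q$ in $\chi$, and $\Gamma[f(\overline p)/\overline p]$ is defined elementwise. For $\vdash_*\in\Lambda(\vdash)$, $\vdash_*^f$ is defined by $\Gamma\vdash_*^f\phi$ iff $\Gamma[f(\overline p)/\overline p]\vdash_*\phi[f(\overline p)/\overline p]$. $\Lambda^f(\vdash)=\{\vdash_*^f:\ \vdash_*\in\Lambda(\vdash)\}$, the $\mathsf{PAt}$-$f$-logics ordered by inclusion (a complete lattice). For $\mathcal{A}\in\mathbf{Y}$, $\mathcal{A}^f=\{a\in A:f(a)=a\}$. For $\mathcal{A},\mathcal{B}\in\mathbf{Y}$, $\mathcal{B}\preceq_f\mathcal{A}$ ($\mathcal{A}$ is a core superalgebra of $\mathcal{B}$) means $\mathcal{B}$ is a subalgebra of $\mathcal{A}$ and $\mathcal{A}^f=\mathcal{B}^f$.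 For $\mathbf{K}\in\Xi(\mathbf{Y})$, $\mathbf{K}^\uparrow=\{\mathcal{A}\in\mathbf{Y}:\exists\mathcal{B}\in\mathbf{K},\ \mathcal{B}\preceq_f\mathcal{A}\}$. $\Xi^f(\mathbf{Y})=\{\mathbf{K}^\uparrow:\mathbf{K}\in\Xi(\mathbf{Y})\}$, the $\mathsf{PAt}$-$f$-quasivarieties ordered by inclusion (a complete lattice). $\mathcal{A}\vDash_f(\Gamma,\phi)$ means: for each $v:\mathsf{Prop}\to\mathcal{A}^f$, if $\mathcal{A},v\vDash\mu[\Gamma]$ then $\mathcal{A},v\vDash\mu(\phi)$. $\mathsf{QVar}^f(\vdash_s)=\{\mathcal{A}\in\mathbf{Y}:\mathcal{A}\vDash_f(\Gamma,\phi)\text{ for all }(\Gamma,\phi)\in{\vdash_s}\}$.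
   Formalization: The selector term f is additionally assumed idempotent as an operation, i.e. Y ⊨ f(f(x)) ≈ f(x), not only f(f(x)) ⊣⊢ f(x); with interderivability alone the claim fails (global consequence of the modal logic KTB, f(x) = □x). -}

module Defs where

open import Level using (Level; _⊔_) renaming (suc to lsuc)
open import Data.Fin.Base using (Fin; zero; suc)
open import Data.List.Base as List using (List; [])
import Data.List.Membership.Propositional as ListMembership
open import Data.Nat.Base using (ℕ)
open import Data.Product.Base using (Σ-syntax; ∃; _×_; _,_)
open import Data.Unit.Polymorphic.Base using (⊤; tt)
open import Data.Vec.Base using (Vec; []; _∷_)
import Data.Vec.Functional as VF
open import Function.Base using (_∘_)
open import Function.Bundles using (_⇔_)
open import Function.Definitions using (Congruent; Injective; StrictlySurjective)
open import Relation.Binary.Bundles using (Poset; Setoid)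
open import Relation.Binary.Construct.Interior.Symmetric using (poset)
open import Relation.Binary.Core using (REL; _⇒_) renaming (_⇔_ to _⇔₂_)
open import Relation.Binary.Morphism.Structures using (IsOrderIsomorphism)
open import Relation.Unary using (Pred; _∈_; _⊆_; _≐_; _∩_; ｛_｝)

private
  variable
    a x y z ℓ : Level
    X : Set x
    Z : Set z

-- The subset of A listed by xs.
⌊_⌋ : {A : Set a} → List A → Pred A a
⌊ xs ⌋ e = e ListMembership.∈ xs

------------------------------------------------------------------------
-- Terms and equations

record Signature ℓ : Set (lsuc ℓ) where
  field
    Op    : Set ℓ
    arity : Op → ℕ

open Signature public

data Term (𝓛 : Signature ℓ) {x} (X : Set x) : Set (ℓ ⊔ x) where
  var : X → Term 𝓛 X
  app : (o : Op 𝓛) → Vec (Term 𝓛 X) (arity 𝓛 o) → Term 𝓛 X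

-- Prop is ℕ.
Formula : Signature ℓ → Set ℓ
Formula 𝓛 = Term 𝓛 ℕ

-- The pair (s , t) stands for s ≈ t.
Equation : Signature ℓ → Set x → Set (ℓ ⊔ x)
Equation 𝓛 X = Term 𝓛 X × Term 𝓛 X

private
  variable
    𝓛 : Signature ℓ

mutual
  _[_] : Term 𝓛 X → (X → Term 𝓛 Z) → Term 𝓛 Z
  var i    [ σ ] = σ i
  app o ts [ σ ] = app o (ts [ σ ]*)

  _[_]* : ∀ {n} → Vec (Term 𝓛 X) n → (X → Term 𝓛 Z) → Vec (Term 𝓛 Z) n
  []       [ σ ]* = []
  (t ∷ ts) [ σ ]* = (t [ σ ]) ∷ (ts [ σ ]*)

_⟨_⟩ : Term 𝓛 (Fin 1) → Term 𝓛 X → Term 𝓛 X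
t ⟨ s ⟩ = t [ (λ _ → s) ]

_[_]ˢ : Pred (Formula 𝓛) ℓ → (ℕ → Formula 𝓛) → Pred (Formula 𝓛) _
(Γ [ σ ]ˢ) ψ = ∃ λ χ → χ ∈ Γ × ｛ χ [ σ ] ｝ ψ

------------------------------------------------------------------------
-- Logics

Consequence : Signature ℓ → Set (lsuc (lsuc ℓ))
Consequence {ℓ} 𝓛 = REL (Pred (Formula 𝓛) ℓ) (Formula 𝓛) (lsuc ℓ)

record Logic (𝓛 : Signature ℓ) : Set (lsuc (lsuc ℓ)) where
  infix 4 _⊢_ _⊢ˢ_
  field
    _⊢_        : Consequence 𝓛
    reflexive  : ∀ {Γ φ} → φ ∈ Γ → Γ ⊢ φ
    cut        : ∀ {Γ Γ′ φ} → (∀ {ψ} → ψ ∈ Γ′ → Γ ⊢ ψ) → Γ′ ⊢ φ → Γ ⊢ φ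
    finitary   : ∀ {Γ φ} → Γ ⊢ φ → ∃ λ Γ₀ → ⌊ Γ₀ ⌋ ⊆ Γ × ⌊ Γ₀ ⌋ ⊢ φ
    structural : ∀ {Γ φ} (σ : ℕ → Formula 𝓛) → Γ ⊢ φ → Γ [ σ ]ˢ ⊢ φ [ σ ]

  _⊢ˢ_ : Pred (Formula 𝓛) ℓ → Pred (Formula 𝓛) ℓ → Set (lsuc ℓ)
  Γ ⊢ˢ Γ′ = ∀ {ψ} → ψ ∈ Γ′ → Γ ⊢ ψ

⊢-of : Logic 𝓛 → Consequence 𝓛
⊢-of = Logic._⊢_

------------------------------------------------------------------------
-- Algebras

-- Carriers are setoids, whose _≈_ plays the role of equality; this is what
-- makes quotients, hence reduced products, available.
record Algebra (𝓛 : Signature ℓ) : Set (lsuc ℓ) where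
  field
    setoid : Setoid ℓ ℓ

  open Setoid setoid public

  field
    op         : (o : Op 𝓛) → (Fin (arity 𝓛 o) → Carrier) → Carrier
    op-cong    : ∀ o {as bs} → (∀ k → as k ≈ bs k) → op o as ≈ op o bs
    inhabitant : Carrier

∣_∣ : Algebra 𝓛 → Set _
∣ 𝒜 ∣ = Algebra.Carrier 𝒜

module _ (𝒜 : Algebra 𝓛) where
  open Algebra 𝒜

  mutual
    ⟦_⟧ : Term 𝓛 X → (X → Carrier) → Carrier
    ⟦ var i    ⟧ v = v i
    ⟦ app o ts ⟧ v = op o (⟦ ts ⟧* v)

    ⟦_⟧* : ∀ {n} → Vec (Term 𝓛 X) n → (X → Carrier) → Fin n → Carrier
    ⟦ t ∷ ts ⟧* v zero    = ⟦ t ⟧ v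
    ⟦ t ∷ ts ⟧* v (suc k) = ⟦ ts ⟧* v k

  infix 4 _⊨_ _⊨ˢ_
  _⊨_ : (X → Carrier) → Equation 𝓛 X → Set _
  v ⊨ (s , t) = ⟦ s ⟧ v ≈ ⟦ t ⟧ v

  _⊨ˢ_ : (X → Carrier) → Pred (Equation 𝓛 X) y → Set _
  v ⊨ˢ Θ = ∀ {e} → e ∈ Θ → v ⊨ e

record IsHomomorphism {𝓛 : Signature ℓ} (ℬ 𝒜 : Algebra 𝓛) (h : ∣ ℬ ∣ → ∣ 𝒜 ∣) : Set ℓ where
  private
    module ℬ = Algebra ℬ
    module 𝒜 = Algebra 𝒜
  field
    cong : Congruent ℬ._≈_ 𝒜._≈_ h
    homo : ∀ o bs → h (ℬ.op o bs) 𝒜.≈ 𝒜.op o (h ∘ bs)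

-- "ℬ is a subalgebra of 𝒜" is rendered as "ℬ embeds into 𝒜", there being no
-- literal inclusion between types; ℬ is identified with its image.
record _↪_ {𝓛 : Signature ℓ} (ℬ 𝒜 : Algebra 𝓛) : Set ℓ where
  field
    to             : ∣ ℬ ∣ → ∣ 𝒜 ∣
    isHomomorphism : IsHomomorphism ℬ 𝒜 to
    injective      : Injective (Algebra._≈_ ℬ) (Algebra._≈_ 𝒜) to

record _≅_ {𝓛 : Signature ℓ} (ℬ 𝒜 : Algebra 𝓛) : Set ℓ where
  field
    embedding  : ℬ ↪ 𝒜
    surjective : StrictlySurjective (Algebra._≈_ 𝒜) (_↪_.to embedding)

-- The improper filter and the empty index set are allowed, so the trivial
-- algebra is a reduced product of any class, the empty one included.
record Filter {ℓ} (I : Set ℓ) : Set (lsuc ℓ) where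
  field
    Large      : Pred (Pred I ℓ) ℓ
    full       : (λ _ → ⊤) ∈ Large
    ∩-closed   : ∀ {P Q} → P ∈ Large → Q ∈ Large → (P ∩ Q) ∈ Large
    upward     : ∀ {P Q} → P ⊆ Q → P ∈ Large → Q ∈ Large

module _ {𝓛 : Signature ℓ} {I : Set ℓ} (F : Filter I) (𝒜 : I → Algebra 𝓛) where
  open Filter F
  private module 𝒜 i = Algebra (𝒜 i)

  large-⋂ : ∀ n {P : Fin n → Pred I ℓ} → (∀ k → P k ∈ Large) →
            (λ i → ∀ k → P k i) ∈ Large
  large-⋂ ℕ.zero    large = upward (λ _ ()) full
  large-⋂ (ℕ.suc n) large =
    upward (λ { (p , ps) zero → p ; (p , ps) (suc k) → ps k })
           (∩-closed (large zero) (large-⋂ n (large ∘ suc)))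

  reducedProduct : Algebra 𝓛
  reducedProduct = record
    { setoid = record
      { Carrier       = ∀ i → ∣ 𝒜 i ∣
      ; _≈_           = λ as bs → (λ i → 𝒜._≈_ i (as i) (bs i)) ∈ Large
      ; isEquivalence = record
        { refl  = upward (λ {i} _ → 𝒜.refl i) full
        ; sym   = upward (λ {i} → 𝒜.sym i)
        ; trans = λ p q → upward (λ {i} (r , s) → 𝒜.trans i r s) (∩-closed p q)
        }
      }
    ; op         = λ o as i → 𝒜.op i o (λ k → as k i)
    ; op-cong    = λ o eqs → upward (λ {i} → 𝒜.op-cong i o) (large-⋂ (arity 𝓛 o) eqs)
    ; inhabitant = 𝒜.inhabitant
    }

------------------------------------------------------------------------
-- Quasivarieties

Class : Signature ℓ → Set (lsuc (lsuc ℓ))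
Class {ℓ} 𝓛 = Pred (Algebra 𝓛) (lsuc ℓ)

record Quasivariety (𝓛 : Signature ℓ) : Set (lsuc (lsuc ℓ)) where
  field
    Member                 : Class 𝓛
    iso-closed             : ∀ {𝒜 ℬ} → ℬ ≅ 𝒜 → 𝒜 ∈ Member → ℬ ∈ Member
    subalgebra-closed      : ∀ {𝒜 ℬ} → ℬ ↪ 𝒜 → 𝒜 ∈ Member → ℬ ∈ Member
    reducedProduct-closed  : ∀ {I : Set ℓ} (F : Filter I) (𝒜 : I → Algebra 𝓛) →
                             (∀ i → 𝒜 i ∈ Member) → reducedProduct F 𝒜 ∈ Member

open Quasivariety public using (Member)

infix 4 _⊨[_]_ _⊨[_]ˢ_
_⊨[_]_ : {𝓛 : Signature ℓ} → Pred (Equation 𝓛 ℕ) ℓ → Class 𝓛 → Equation 𝓛 ℕ → Set (lsuc ℓ)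
Θ ⊨[ 𝐊 ] e = ∀ 𝒜 → 𝒜 ∈ 𝐊 → (v : ℕ → ∣ 𝒜 ∣) → _⊨ˢ_ 𝒜 v Θ → _⊨_ 𝒜 v e

_⊨[_]ˢ_ : {𝓛 : Signature ℓ} → Pred (Equation 𝓛 ℕ) ℓ → Class 𝓛 → Pred (Equation 𝓛 ℕ) ℓ → Set (lsuc ℓ)
Θ ⊨[ 𝐊 ]ˢ Θ′ = ∀ {e} → e ∈ Θ′ → Θ ⊨[ 𝐊 ] e

------------------------------------------------------------------------
-- Algebraizability

module _ {𝓛 : Signature ℓ} where

  -- μ ⟪ φ ⟫ is μ(φ) and μ ⟪ Γ ⟫ˢ is μ[Γ].
  infix 8 _⟪_⟫ _⟪_⟫ˢ
  _⟪_⟫ : List (Equation 𝓛 (Fin 1)) → Formula 𝓛 → Pred (Equation 𝓛 ℕ) ℓ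
  μ ⟪ φ ⟫ = ⌊ List.map (λ (s , t) → s ⟨ φ ⟩ , t ⟨ φ ⟩) μ ⌋

  _⟪_⟫ˢ : List (Equation 𝓛 (Fin 1)) → Pred (Formula 𝓛) ℓ → Pred (Equation 𝓛 ℕ) ℓ
  (μ ⟪ Γ ⟫ˢ) e = ∃ λ ψ → ψ ∈ Γ × e ∈ μ ⟪ ψ ⟫

  -- Δ ⟦ γ , δ ⟧ₑ is Δ(γ,δ) and Δ ⟦ Θ ⟧ₑˢ is Δ[Θ].
  infix 8 _⟦_⟧ₑ _⟦_⟧ₑˢ
  _⟦_⟧ₑ : List (Term 𝓛 (Fin 2)) → Equation 𝓛 ℕ → Pred (Formula 𝓛) ℓ
  Δ ⟦ γ , δ ⟧ₑ = ⌊ List.map (_[ γ VF.∷ δ VF.∷ VF.[] ]) Δ ⌋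

  _⟦_⟧ₑˢ : List (Term 𝓛 (Fin 2)) → Pred (Equation 𝓛 ℕ) ℓ → Pred (Formula 𝓛) ℓ
  (Δ ⟦ Θ ⟧ₑˢ) ψ = ∃ λ e → e ∈ Θ × ψ ∈ Δ ⟦ e ⟧ₑ

record IsAlgebraizable {𝓛 : Signature ℓ} (L : Logic 𝓛) (𝐘 : Quasivariety 𝓛)
                       (μ : List (Equation 𝓛 (Fin 1))) (Δ : List (Term 𝓛 (Fin 2)))
                       : Set (lsuc ℓ) where
  open Logic L
  field
    ⊢⇔⊨ : ∀ Γ φ → Γ ⊢ φ ⇔ (μ ⟪ Γ ⟫ˢ ⊨[ Member 𝐘 ]ˢ μ ⟪ φ ⟫)
    ⊨⇔⊢ : ∀ Θ e → Θ ⊨[ Member 𝐘 ] e ⇔ (Δ ⟦ Θ ⟧ₑˢ ⊢ˢ Δ ⟦ e ⟧ₑ)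
    φ⊢Δμ : ∀ φ → ｛ φ ｝ ⊢ˢ Δ ⟦ μ ⟪ φ ⟫ ⟧ₑˢ
    Δμ⊢φ : ∀ φ → Δ ⟦ μ ⟪ φ ⟫ ⟧ₑˢ ⊢ φ
    e⊨μΔ : ∀ e → ｛ e ｝ ⊨[ Member 𝐘 ]ˢ μ ⟪ Δ ⟦ e ⟧ₑ ⟫ˢ
    μΔ⊨e : ∀ e → μ ⟪ Δ ⟦ e ⟧ₑ ⟫ˢ ⊨[ Member 𝐘 ] e

------------------------------------------------------------------------
-- Selector terms

IsSelector : {𝓛 : Signature ℓ} → Logic 𝓛 → Term 𝓛 (Fin 1) → Set (lsuc ℓ)
IsSelector L f = (｛ f ⟨ f ⟨ p ⟩ ⟩ ｝ ⊢ f ⟨ p ⟩) × (｛ f ⟨ p ⟩ ｝ ⊢ f ⟨ f ⟨ p ⟩ ⟩)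
  where
  open Logic L
  p = var 0

-- Idempotence of f as an operation, 𝐘 ⊨ f(f(x)) ≈ f(x).  It implies
-- IsSelector, but not conversely, and the duality needs it: without it the
-- values of f need not be fixed points of f.  In the global consequence of the
-- modal logic KTB, f(x) = □x satisfies IsSelector, yet QVarᶠ sends both Lᶠ and
-- L′ᶠ to 𝐘, where L is that logic and L′ ⊋ L is its extension by p → □p,
-- although p → □p is a theorem of L′ᶠ and not of Lᶠ.
IsIdempotent : {𝓛 : Signature ℓ} → Quasivariety 𝓛 → Term 𝓛 (Fin 1) → Set (lsuc ℓ)
IsIdempotent 𝐘 f = ⌊ [] ⌋ ⊨[ Member 𝐘 ] (f ⟨ f ⟨ p ⟩ ⟩ , f ⟨ p ⟩)
  where p = var 0

------------------------------------------------------------------------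
-- PAt-f-logics

module _ {𝓛 : Signature ℓ} (f : Term 𝓛 (Fin 1)) where

  _ᶠ : Consequence 𝓛 → Consequence 𝓛
  (_⊢⋆_ ᶠ) Γ φ = (Γ [ f[p] ]ˢ) ⊢⋆ (φ [ f[p] ])
    where f[p] = λ q → f ⟨ var q ⟩

module _ {𝓛 : Signature ℓ} (L : Logic 𝓛) (f : Term 𝓛 (Fin 1)) where

  IsPAtLogic : Consequence 𝓛 → Set (lsuc (lsuc ℓ))
  IsPAtLogic _⊢ₛ_ = ∃ λ (L⋆ : Logic 𝓛) → (⊢-of L ⇒ ⊢-of L⋆) × (_⊢ₛ_ ⇔₂ (f ᶠ) (⊢-of L⋆))

  -- Equality of the poset is mutual inclusion.
  Λᶠ : Poset (lsuc (lsuc ℓ)) (lsuc ℓ) (lsuc ℓ)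
  Λᶠ = poset {A = ∃ IsPAtLogic} {R = λ (s , _) (t , _) → s ⇒ t}
         (λ s⊢φ → s⊢φ) (λ s⇒t t⇒u s⊢φ → t⇒u (s⇒t s⊢φ))

------------------------------------------------------------------------
-- PAt-f-quasivarieties

Core : {𝓛 : Signature ℓ} (𝒜 : Algebra 𝓛) → Term 𝓛 (Fin 1) → Pred ∣ 𝒜 ∣ ℓ
Core 𝒜 f a = ⟦ 𝒜 ⟧ f (λ _ → a) ≈ a
  where open Algebra 𝒜

-- 𝒜ᶠ = ℬᶠ, with ℬ identified with its image in 𝒜.
_≼[_]_ : {𝓛 : Signature ℓ} → Algebra 𝓛 → Term 𝓛 (Fin 1) → Algebra 𝓛 → Set ℓ
ℬ ≼[ f ] 𝒜 = Σ[ h ∈ ℬ ↪ 𝒜 ] Core 𝒜 f ≐ λ a → ∃ λ b → b ∈ Core ℬ f × _↪_.to h b ≈ a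
  where open Algebra 𝒜

module _ {𝓛 : Signature ℓ} (𝐘 : Quasivariety 𝓛) (f : Term 𝓛 (Fin 1)) where

  _↑ : Class 𝓛 → Class 𝓛
  (𝐊 ↑) 𝒜 = 𝒜 ∈ Member 𝐘 × ∃ λ ℬ → ℬ ∈ 𝐊 × ℬ ≼[ f ] 𝒜

  IsPAtQuasivariety : Class 𝓛 → Set (lsuc (lsuc ℓ))
  IsPAtQuasivariety 𝐂 = ∃ λ (𝐊 : Quasivariety 𝓛) → Member 𝐊 ⊆ Member 𝐘 × 𝐂 ≐ (Member 𝐊 ↑)

  Ξᶠ : Poset (lsuc (lsuc ℓ)) (lsuc ℓ) (lsuc ℓ)
  Ξᶠ = poset {A = ∃ IsPAtQuasivariety} {R = λ (𝐂 , _) (𝐃 , _) → 𝐂 ⊆ 𝐃}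
         (λ a∈𝐂 → a∈𝐂) (λ 𝐂⊆𝐃 𝐃⊆𝐄 a∈𝐂 → 𝐃⊆𝐄 (𝐂⊆𝐃 a∈𝐂))

------------------------------------------------------------------------
-- The map QVarᶠ

module _ {𝓛 : Signature ℓ} (𝐘 : Quasivariety 𝓛) (μ : List (Equation 𝓛 (Fin 1)))
         (f : Term 𝓛 (Fin 1)) where

  _⊨ᶠ_ : Algebra 𝓛 → Pred (Formula 𝓛) ℓ × Formula 𝓛 → Set ℓ
  𝒜 ⊨ᶠ (Γ , φ) = (v : ℕ → ∣ 𝒜 ∣) → (∀ p → v p ∈ Core 𝒜 f) →
                 _⊨ˢ_ 𝒜 v (μ ⟪ Γ ⟫ˢ) → _⊨ˢ_ 𝒜 v (μ ⟪ φ ⟫)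

  QVarᶠ : Consequence 𝓛 → Class 𝓛
  QVarᶠ _⊢ₛ_ 𝒜 = 𝒜 ∈ Member 𝐘 × (∀ {Γ φ} → Γ ⊢ₛ φ → 𝒜 ⊨ᶠ (Γ , φ))

------------------------------------------------------------------------
-- Complete lattices and dual isomorphisms

module _ {c ℓ₁ ℓ₂} (P : Poset c ℓ₁ ℓ₂) where
  open Poset P

  IsSupremum : {I : Set ℓ} → (I → Carrier) → Carrier → Set _
  IsSupremum xs s = (∀ i → xs i ≤ s) × (∀ t → (∀ i → xs i ≤ t) → s ≤ t)

  IsInfimum : {I : Set ℓ} → (I → Carrier) → Carrier → Set _
  IsInfimum xs s = (∀ i → s ≤ xs i) × (∀ t → (∀ i → t ≤ xs i) → t ≤ s)

  -- Families indexed at the level of the carrier cover all its subsets.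
  IsCompleteLattice : Set _
  IsCompleteLattice = {I : Set c} (xs : I → Carrier) → ∃ (IsSupremum xs) × ∃ (IsInfimum xs)

IsDualIsomorphism : ∀ {c ℓ₁ ℓ₂ c′ ℓ₁′ ℓ₂′} (P : Poset c ℓ₁ ℓ₂) (Q : Poset c′ ℓ₁′ ℓ₂′) →
                    (Poset.Carrier P → Poset.Carrier Q) → Set _
IsDualIsomorphism P Q = IsOrderIsomorphism P._≈_ Q._≈_ P._≤_ Q._≥_
  where
  module P = Poset P
  module Q = Poset Q

{-# OPTIONS --safe #-}
module Submission where

-- Three constructions carry the duality, for a logic T extending the given one.
--
-- * The models of T in 𝐘 form a quasivariety, and QVarᶠ(Tᶠ) consists of their
--   core superalgebras (QVarᶠ-Models).  An inference of Tᶠ speaks about values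
--   of f, which by idempotence are the core elements, and a core superalgebra
--   has the core elements of its subalgebra.  Conversely, if 𝒜 ⊨ᶠ Tᶠ, then the
--   subalgebra generated by the core of 𝒜 is a model of T: an assignment into
--   it is a substitution followed by an assignment into the core, and T is
--   closed under substitution.  Hence QVarᶠ does land in Ξᶠ(𝐘).
--
-- * For a set Γ of formulas, the term algebra modulo Γ ⊢ Δ(s,t) is a model of T
--   in which exactly the consequences of Γ are true (lindenbaum-truth).  For
--   Γ[f(p)/p], the assignment p ↦ f(p) takes its values in the core, so this
--   single algebra decides which conclusions of Γ belong to Tᶠ.  This makes
--   QVarᶠ reflect the order, hence injective (QVarᶠ-reflects).
--
-- * A quasivariety 𝐊 contained in 𝐘 is the class of models of its own logic
--   (Models-logicOf), because Δ and μ translate a quasi-equation into an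
--   inference and back.  With the first point, QVarᶠ is surjective.
--
-- The last two constructions must show that an algebra belongs to a class known
-- only by its closure properties.  That is Maltsev's theorem (maltsev): an
-- algebra satisfying all finite quasi-equations of a quasivariety embeds into a
-- reduced product of members, namely of countermodels to its false equations.
--
-- An infimum in Λᶠ is induced by the finitary part of an intersection of logics;
-- suprema then exist as infima of upper bounds, and completeness of Ξᶠ is
-- transported along the dual isomorphism.
--
-- Excluded middle supplies countermodels, decidable equality of elements, and
-- the collapse of propositions to a smaller universe.

open import Defs
open import Level using (Level; _⊔_; Lift; lift; lower) renaming (suc to lsuc)
open import Axiom.DoubleNegationElimination using (em⇒dne)
open import Axiom.ExcludedMiddle using (ExcludedMiddle)
open import Data.Empty.Polymorphic using (⊥)
open import Data.Fin.Base using (Fin; zero; suc)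
open import Data.List.Base as List using (List; []; _∷_; _++_; concatMap)
open import Data.List.Membership.Propositional using (find; lose)
open import Data.List.Membership.Propositional.Properties using (∈-++⁺ˡ; ∈-++⁺ʳ; ∈-++⁻; ∈-concatMap⁺; ∈-concatMap⁻; ∈-map⁺; ∈-map⁻; ∈-tabulate⁺; ∈-tabulate⁻)
open import Data.List.Relation.Unary.Any using (here; there)
open import Data.Nat.Base using (ℕ; zero; suc)
open import Data.Product.Base using (Σ-syntax; ∃; ∃₂; _×_; _,_; proj₁; proj₂)
open import Data.Sum.Base using ([_,_]′)
open import Data.Unit.Polymorphic.Base using (⊤; tt)
open import Data.Vec.Base as Vec using (Vec; []; _∷_)
import Data.Vec.Functional as VF
open import Function.Base using (_∘_; const; id)
open import Function.Bundles using (_⇔_; mk⇔; Equivalence)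
open import Relation.Binary.Bundles using (Poset)
open import Relation.Binary.Construct.Interior.Symmetric using (_,_)
import Relation.Binary.Construct.On as On
open import Relation.Binary.Core using (_⇒_) renaming (_⇔_ to _⇔₂_)
open import Relation.Binary.Definitions using (DecidableEquality)
open import Relation.Binary.Morphism.Structures using (IsOrderIsomorphism)
open import Relation.Binary.PropositionalEquality using (_≡_; refl; sym; cong; cong₂; subst)
import Relation.Binary.Reasoning.Setoid as ≈-Reasoning
open import Relation.Nullary.Decidable.Core using (Dec; yes; no; map′)
open import Relation.Nullary.Negation.Core using (¬_; contradiction)
open import Relation.Unary using (Pred; _∈_; _⊆_; _≐_)

open Equivalence using (to; from)

private
  variable
    a b c p ℓ ℓ₁ ℓ₂ x z : Level
    P : Set p
    X : Set x
    Z : Set z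
    n : ℕ
    𝓛 : Signature ℓ

------------------------------------------------------------------------
-- Consequences of excluded middle

lower-em : ∀ b → ExcludedMiddle (a ⊔ b) → ExcludedMiddle a
lower-em b em {P} = map′ lower lift (em {Lift b P})

-- Propositional resizing.  Logics and congruences live in fixed universes, below
-- those of the quantifications over logics or derivations that define them.
Squash : ∀ b → Dec P → Set b
Squash b (yes _) = ⊤
Squash b (no _)  = ⊥

squash : (P? : Dec P) → P → Squash b P?
squash (yes _) _ = tt
squash (no ¬p) p = contradiction p ¬p

unsquash : (P? : Dec P) → Squash b P? → P
unsquash (yes p) _ = p

-- Quasi-equations and inferences use variables from ℕ, whereas arguments below
-- take the elements of an algebra as variables.  Finitely many elements can be
-- named by numbers, with ρ reading back what ι names; x₀ is the value of the
-- numbers that name nothing.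
enumerate : DecidableEquality X → X → (xs : List X) →
            ∃₂ λ (ι : X → ℕ) (ρ : ℕ → X) → ∀ {x} → x ∈ ⌊ xs ⌋ → ρ (ι x) ≡ x
enumerate         _≟_ x₀ []       = const 0 , const x₀ , λ ()
enumerate {X = X} _≟_ x₀ (x ∷ xs) with enumerate _≟_ x₀ xs
... | ι , ρ , ρι≡id = ι′ , ρ′ , ρ′ι′≡id
  where
  ι′ : X → ℕ
  ι′ y with y ≟ x
  ... | yes _ = zero
  ... | no _  = suc (ι y)

  ρ′ : ℕ → X
  ρ′ zero    = x
  ρ′ (suc n) = ρ n

  ρ′ι′≡id : ∀ {y} → y ∈ ⌊ x ∷ xs ⌋ → ρ′ (ι′ y) ≡ y
  ρ′ι′≡id {y} y∈x∷xs with y ≟ x | y∈x∷xs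
  ... | yes refl | _          = refl
  ... | no y≢x   | here y≡x   = contradiction y≡x y≢x
  ... | no _     | there y∈xs = ρι≡id y∈xs

------------------------------------------------------------------------
-- Complete lattices

complete-by-infima : (P : Poset (c ⊔ ℓ₂) ℓ₁ ℓ₂) →
  ({I : Set (c ⊔ ℓ₂)} (xs : I → Poset.Carrier P) → ∃ (IsInfimum P xs)) →
  IsCompleteLattice P
complete-by-infima P inf xs = (u , xs≤u , u-least) , inf xs
  where
  open Poset P
  bounds : (∃ λ t → ∀ i → xs i ≤ t) → Carrier
  bounds = proj₁
  u = proj₁ (inf bounds)
  xs≤u : ∀ i → xs i ≤ u
  xs≤u i = proj₂ (proj₂ (inf bounds)) (xs i) (λ (_ , xs≤t) → xs≤t i)
  u-least : ∀ t → (∀ i → xs i ≤ t) → u ≤ t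
  u-least t xs≤t = proj₁ (proj₂ (inf bounds)) (t , xs≤t)

-- The lattice operations of Q are those of P on preimages, exchanged.
dual-complete : (P Q : Poset c ℓ₁ ℓ₂) (g : Poset.Carrier P → Poset.Carrier Q) →
  IsDualIsomorphism P Q g → IsCompleteLattice P → IsCompleteLattice Q
dual-complete P Q g g-iso complete {I} xs =
    (g m , xs≤gm , gm-least) , (g j , gj≤xs , gj-greatest)
  where
  module P = Poset P
  module Q = Poset Q
  open IsOrderIsomorphism g-iso

  preimage : Q.Carrier → P.Carrier
  preimage y = proj₁ (surjective y)

  g-preimage : ∀ y → g (preimage y) Q.≈ y
  g-preimage y = proj₂ (surjective y) P.Eq.refl

  ys : I → P.Carrier
  ys = preimage ∘ xs

  j = proj₁ (proj₁ (complete ys))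
  m = proj₁ (proj₂ (complete ys))

  xs≤gm : ∀ i → xs i Q.≤ g m
  xs≤gm i = Q.trans (Q.reflexive (Q.Eq.sym (g-preimage (xs i))))
                    (mono (proj₁ (proj₂ (proj₂ (complete ys))) i))

  gm-least : ∀ t → (∀ i → xs i Q.≤ t) → g m Q.≤ t
  gm-least t xs≤t =
    Q.trans (mono (proj₂ (proj₂ (proj₂ (complete ys))) (preimage t) λ i →
              cancel (Q.trans (Q.reflexive (g-preimage (xs i)))
                     (Q.trans (xs≤t i) (Q.reflexive (Q.Eq.sym (g-preimage t)))))))
            (Q.reflexive (g-preimage t))

  gj≤xs : ∀ i → g j Q.≤ xs i
  gj≤xs i = Q.trans (mono (proj₁ (proj₂ (proj₁ (complete ys))) i))
                    (Q.reflexive (g-preimage (xs i)))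

  gj-greatest : ∀ t → (∀ i → t Q.≤ xs i) → t Q.≤ g j
  gj-greatest t t≤xs =
    Q.trans (Q.reflexive (Q.Eq.sym (g-preimage t)))
            (mono (proj₂ (proj₂ (proj₁ (complete ys))) (preimage t) λ i →
              cancel (Q.trans (Q.reflexive (g-preimage t))
                     (Q.trans (t≤xs i) (Q.reflexive (Q.Eq.sym (g-preimage (xs i))))))))

------------------------------------------------------------------------
-- Evaluation of terms

mutual
  vars : Term 𝓛 X → List X
  vars (var x)    = x ∷ []
  vars (app o ts) = vars* ts

  vars* : Vec (Term 𝓛 X) n → List X
  vars* []       = []
  vars* (t ∷ ts) = vars t ++ vars* ts

varsₑ : Equation 𝓛 X → List X
varsₑ (s , t) = vars s ++ vars t

infix 9 _[_]ₑ
_[_]ₑ : Equation 𝓛 X → (X → Term 𝓛 Z) → Equation 𝓛 Z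
(s , t) [ σ ]ₑ = s [ σ ] , t [ σ ]

module _ (𝒜 : Algebra 𝓛) where
  private module 𝒜 = Algebra 𝒜

  mutual
    ⟦⟧-agree : (t : Term 𝓛 X) {v w : X → ∣ 𝒜 ∣} →
               (∀ {x} → x ∈ ⌊ vars t ⌋ → v x 𝒜.≈ w x) → ⟦ 𝒜 ⟧ t v 𝒜.≈ ⟦ 𝒜 ⟧ t w
    ⟦⟧-agree (var x)    v≈w = v≈w (here refl)
    ⟦⟧-agree (app o ts) v≈w = 𝒜.op-cong o (⟦⟧*-agree ts v≈w)

    ⟦⟧*-agree : (ts : Vec (Term 𝓛 X) n) {v w : X → ∣ 𝒜 ∣} →
                (∀ {x} → x ∈ ⌊ vars* ts ⌋ → v x 𝒜.≈ w x) →
                ∀ k → ⟦ 𝒜 ⟧* ts v k 𝒜.≈ ⟦ 𝒜 ⟧* ts w k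
    ⟦⟧*-agree (t ∷ ts) v≈w zero    = ⟦⟧-agree t (v≈w ∘ ∈-++⁺ˡ)
    ⟦⟧*-agree (t ∷ ts) v≈w (suc k) = ⟦⟧*-agree ts (v≈w ∘ ∈-++⁺ʳ (vars t)) k

  ⟦⟧-cong : (t : Term 𝓛 X) {v w : X → ∣ 𝒜 ∣} →
            (∀ x → v x 𝒜.≈ w x) → ⟦ 𝒜 ⟧ t v 𝒜.≈ ⟦ 𝒜 ⟧ t w
  ⟦⟧-cong t v≈w = ⟦⟧-agree t (λ {x} _ → v≈w x)

  mutual
    ⟦⟧-subst : (t : Term 𝓛 X) (σ : X → Term 𝓛 Z) (v : Z → ∣ 𝒜 ∣) →
               ⟦ 𝒜 ⟧ (t [ σ ]) v 𝒜.≈ ⟦ 𝒜 ⟧ t (λ x → ⟦ 𝒜 ⟧ (σ x) v)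
    ⟦⟧-subst (var x)    σ v = 𝒜.refl
    ⟦⟧-subst (app o ts) σ v = 𝒜.op-cong o (⟦⟧*-subst ts σ v)

    ⟦⟧*-subst : (ts : Vec (Term 𝓛 X) n) (σ : X → Term 𝓛 Z) (v : Z → ∣ 𝒜 ∣) →
                ∀ k → ⟦ 𝒜 ⟧* (ts [ σ ]*) v k 𝒜.≈ ⟦ 𝒜 ⟧* ts (λ x → ⟦ 𝒜 ⟧ (σ x) v) k
    ⟦⟧*-subst (t ∷ ts) σ v zero    = ⟦⟧-subst t σ v
    ⟦⟧*-subst (t ∷ ts) σ v (suc k) = ⟦⟧*-subst ts σ v k

  ⟦⟧*-tabulate : (ts : Fin n → Term 𝓛 X) (v : X → ∣ 𝒜 ∣) →
                 ∀ k → ⟦ 𝒜 ⟧* (Vec.tabulate ts) v k ≡ ⟦ 𝒜 ⟧ (ts k) v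
  ⟦⟧*-tabulate ts v zero    = refl
  ⟦⟧*-tabulate ts v (suc k) = ⟦⟧*-tabulate (ts ∘ suc) v k

  app-tabulate : ∀ o (ts : Fin (arity 𝓛 o) → Term 𝓛 X) (v : X → ∣ 𝒜 ∣) →
                 ⟦ 𝒜 ⟧ (app o (Vec.tabulate ts)) v 𝒜.≈ 𝒜.op o (λ k → ⟦ 𝒜 ⟧ (ts k) v)
  app-tabulate o ts v = 𝒜.op-cong o (λ k → 𝒜.reflexive (⟦⟧*-tabulate ts v k))

  ⊨-agree : (e : Equation 𝓛 X) {v w : X → ∣ 𝒜 ∣} →
            (∀ {x} → x ∈ ⌊ varsₑ e ⌋ → v x 𝒜.≈ w x) → (𝒜 ⊨ v) e → (𝒜 ⊨ w) e
  ⊨-agree (s , t) v≈w v⊨e =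
    𝒜.trans (𝒜.sym (⟦⟧-agree s (v≈w ∘ ∈-++⁺ˡ)))
            (𝒜.trans v⊨e (⟦⟧-agree t (v≈w ∘ ∈-++⁺ʳ (vars s))))

  ⊨-cong : (e : Equation 𝓛 X) {v w : X → ∣ 𝒜 ∣} →
           (∀ x → v x 𝒜.≈ w x) → (𝒜 ⊨ v) e → (𝒜 ⊨ w) e
  ⊨-cong e v≈w = ⊨-agree e (λ {x} _ → v≈w x)

  ⊨-subst : (e : Equation 𝓛 X) (σ : X → Term 𝓛 Z) (v : Z → ∣ 𝒜 ∣) →
            (𝒜 ⊨ v) (e [ σ ]ₑ) ⇔ (𝒜 ⊨ λ x → ⟦ 𝒜 ⟧ (σ x) v) e
  ⊨-subst (s , t) σ v = mk⇔
    (λ h → 𝒜.trans (𝒜.sym (⟦⟧-subst s σ v)) (𝒜.trans h (⟦⟧-subst t σ v)))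
    (λ h → 𝒜.trans (⟦⟧-subst s σ v) (𝒜.trans h (𝒜.sym (⟦⟧-subst t σ v))))

module _ {ℬ 𝒜 : Algebra 𝓛} {h : ∣ ℬ ∣ → ∣ 𝒜 ∣} (hom : IsHomomorphism ℬ 𝒜 h) where
  private
    module ℬ = Algebra ℬ
    module 𝒜 = Algebra 𝒜
  open IsHomomorphism hom using (homo)

  mutual
    ⟦⟧-hom : (t : Term 𝓛 X) (v : X → ∣ ℬ ∣) → h (⟦ ℬ ⟧ t v) 𝒜.≈ ⟦ 𝒜 ⟧ t (h ∘ v)
    ⟦⟧-hom (var x)    v = 𝒜.refl
    ⟦⟧-hom (app o ts) v = 𝒜.trans (homo o _) (𝒜.op-cong o (⟦⟧*-hom ts v))

    ⟦⟧*-hom : (ts : Vec (Term 𝓛 X) n) (v : X → ∣ ℬ ∣) →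
              ∀ k → h (⟦ ℬ ⟧* ts v k) 𝒜.≈ ⟦ 𝒜 ⟧* ts (h ∘ v) k
    ⟦⟧*-hom (t ∷ ts) v zero    = ⟦⟧-hom t v
    ⟦⟧*-hom (t ∷ ts) v (suc k) = ⟦⟧*-hom ts v k

module _ {ℬ 𝒜 : Algebra 𝓛} (h : ℬ ↪ 𝒜) where
  private
    module 𝒜 = Algebra 𝒜
    module h = _↪_ h

  ⊨-embedding : (e : Equation 𝓛 X) (v : X → ∣ ℬ ∣) → (ℬ ⊨ v) e ⇔ (𝒜 ⊨ (h.to ∘ v)) e
  ⊨-embedding (s , t) v = mk⇔
    (λ eq → 𝒜.trans (𝒜.sym (⟦⟧-hom h.isHomomorphism s v))
             (𝒜.trans (IsHomomorphism.cong h.isHomomorphism eq) (⟦⟧-hom h.isHomomorphism t v)))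
    (λ eq → h.injective (𝒜.trans (⟦⟧-hom h.isHomomorphism s v)
             (𝒜.trans eq (𝒜.sym (⟦⟧-hom h.isHomomorphism t v)))))

module _ {𝓛 : Signature ℓ} {I : Set ℓ} (F : Filter I) (𝒜 : I → Algebra 𝓛) where
  open Filter F
  private
    module 𝒜 i = Algebra (𝒜 i)
    ∏𝒜 = reducedProduct F 𝒜


  large-all : {A : Set ℓ} (xs : List A) {P : A → Pred I ℓ} →
              (∀ {x} → x ∈ ⌊ xs ⌋ → P x ∈ Large) →
              (λ i → ∀ {x} → x ∈ ⌊ xs ⌋ → P x i) ∈ Large
  large-all []       large = upward (λ _ ()) full
  large-all (x ∷ xs) large =
    upward (λ { (p , ps) (here refl) → p ; (p , ps) (there x∈xs) → ps x∈xs })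
           (∩-closed (large (here refl)) (large-all xs (large ∘ there)))

  mutual
    ⟦⟧-reducedProduct : (t : Term 𝓛 X) (v : X → ∣ ∏𝒜 ∣) →
      ∀ i → 𝒜._≈_ i (⟦ ∏𝒜 ⟧ t v i) (⟦ 𝒜 i ⟧ t (λ x → v x i))
    ⟦⟧-reducedProduct (var x)    v i = 𝒜.refl i
    ⟦⟧-reducedProduct (app o ts) v i = 𝒜.op-cong i o (λ k → ⟦⟧*-reducedProduct ts v k i)

    ⟦⟧*-reducedProduct : (ts : Vec (Term 𝓛 X) n) (v : X → ∣ ∏𝒜 ∣) →
      ∀ k i → 𝒜._≈_ i (⟦ ∏𝒜 ⟧* ts v k i) (⟦ 𝒜 i ⟧* ts (λ x → v x i) k)
    ⟦⟧*-reducedProduct (t ∷ ts) v zero    i = ⟦⟧-reducedProduct t v i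
    ⟦⟧*-reducedProduct (t ∷ ts) v (suc k) i = ⟦⟧*-reducedProduct ts v k i

  ⊨-reducedProduct : (e : Equation 𝓛 X) (v : X → ∣ ∏𝒜 ∣) →
    (∏𝒜 ⊨ v) e ⇔ ((λ i → (𝒜 i ⊨ λ x → v x i) e) ∈ Large)
  ⊨-reducedProduct (s , t) v = mk⇔
    (upward λ {i} eq → 𝒜.trans i (𝒜.sym i (⟦⟧-reducedProduct s v i))
                         (𝒜.trans i eq (⟦⟧-reducedProduct t v i)))
    (upward λ {i} eq → 𝒜.trans i (⟦⟧-reducedProduct s v i)
                         (𝒜.trans i eq (𝒜.sym i (⟦⟧-reducedProduct t v i))))

------------------------------------------------------------------------
-- Membership in a quasivariety through finite quasi-equations

module _ {𝓛 : Signature ℓ} (em : ExcludedMiddle (lsuc ℓ)) (𝐊 : Quasivariety 𝓛)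
         (𝒜 : Algebra 𝓛)
         (satisfies : ∀ Θ e → ⌊ Θ ⌋ ⊨[ Member 𝐊 ] e →
                      ∀ v → (𝒜 ⊨ˢ v) ⌊ Θ ⌋ → (𝒜 ⊨ v) e)
         where
  private
    module 𝒜 = Algebra 𝒜
    em₀ : ExcludedMiddle ℓ
    em₀ = lower-em (lsuc ℓ) em

    Countermodel : List (Equation 𝓛 ∣ 𝒜 ∣) → Equation 𝓛 ∣ 𝒜 ∣ → Set (lsuc ℓ)
    Countermodel Θ e = ∃ λ ℬ → ℬ ∈ Member 𝐊 ×
                       ∃ λ (w : ∣ 𝒜 ∣ → ∣ ℬ ∣) → (ℬ ⊨ˢ w) ⌊ Θ ⌋ × ¬ (ℬ ⊨ w) e

  -- Otherwise Θ would imply e throughout 𝐊.  Naming the finitely many elements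
  -- that occur turns this into a quasi-equation over ℕ, which 𝒜 then satisfies,
  -- so that e would be true in 𝒜.
  countermodel : ∀ Θ e → (𝒜 ⊨ˢ id) ⌊ Θ ⌋ → ¬ (𝒜 ⊨ id) e → Countermodel Θ e
  countermodel Θ e id⊨Θ id⊭e = em⇒dne em refute
    where
    Θ⁺ = e ∷ Θ
    naming = enumerate (λ _ _ → em₀) 𝒜.inhabitant (concatMap varsₑ Θ⁺)
    ι = proj₁ naming
    ρ = proj₁ (proj₂ naming)

    ι̂ : ∣ 𝒜 ∣ → Formula 𝓛
    ι̂ = var ∘ ι

    ρι≈id : ∀ {d} → d ∈ ⌊ Θ⁺ ⌋ → ∀ {x} → x ∈ ⌊ varsₑ d ⌋ → ρ (ι x) 𝒜.≈ x
    ρι≈id d∈Θ⁺ x∈d =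
      𝒜.reflexive (proj₂ (proj₂ naming) (∈-concatMap⁺ varsₑ (lose d∈Θ⁺ x∈d)))

    ρ⊨Θ : (𝒜 ⊨ˢ ρ) ⌊ List.map (_[ ι̂ ]ₑ) Θ ⌋
    ρ⊨Θ d′∈ with ∈-map⁻ (_[ ι̂ ]ₑ) d′∈
    ... | d , d∈Θ , refl =
      from (⊨-subst 𝒜 d ι̂ ρ) (⊨-agree 𝒜 d (𝒜.sym ∘ ρι≈id (there d∈Θ)) (id⊨Θ d∈Θ))

    refute : ¬ ¬ Countermodel Θ e
    refute none = id⊭e (⊨-agree 𝒜 e (ρι≈id (here refl))
                         (to (⊨-subst 𝒜 e ι̂ ρ) (satisfies _ (e [ ι̂ ]ₑ) valid ρ ρ⊨Θ)))
      where
      valid : ⌊ List.map (_[ ι̂ ]ₑ) Θ ⌋ ⊨[ Member 𝐊 ] e [ ι̂ ]ₑ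
      valid ℬ ℬ∈𝐊 w w⊨Θ = em⇒dne em₀ λ w⊭e →
        none (ℬ , ℬ∈𝐊 , w ∘ ι ,
              (λ {d} d∈Θ → to (⊨-subst ℬ d ι̂ w) (w⊨Θ (∈-map⁺ (_[ ι̂ ]ₑ) d∈Θ))) ,
              w⊭e ∘ from (⊨-subst ℬ e ι̂ w))

  private
    -- An index pairs finitely many true equations of 𝒜 with a false one.
    I : Set ℓ
    I = (∃ λ Θ → (𝒜 ⊨ˢ id) ⌊ Θ ⌋) × (∃ λ e → ¬ (𝒜 ⊨ id) e)

    premises : I → List (Equation 𝓛 ∣ 𝒜 ∣)
    premises ((Θ , _) , _) = Θ

    cm : (i : I) → Countermodel (premises i) (proj₁ (proj₂ i))
    cm ((Θ , id⊨Θ) , (e , id⊭e)) = countermodel Θ e id⊨Θ id⊭e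

    ℬ : I → Algebra 𝓛
    ℬ i = proj₁ (cm i)

    w : (i : I) → ∣ 𝒜 ∣ → ∣ ℬ i ∣
    w i = proj₁ (proj₂ (proj₂ (cm i)))

    w⊨ : ∀ i → (ℬ i ⊨ˢ w i) ⌊ premises i ⌋
    w⊨ i = proj₁ (proj₂ (proj₂ (proj₂ (cm i))))

    w⊭ : ∀ i → ¬ (ℬ i ⊨ w i) (proj₁ (proj₂ i))
    w⊭ i = proj₂ (proj₂ (proj₂ (proj₂ (cm i))))

    -- Generated by the sets of indices whose premises include a given true
    -- equation, so that every true equation holds in almost all countermodels.
    F : Filter I
    F = record
      { Large    = λ P → ∃ λ Θ → (𝒜 ⊨ˢ id) ⌊ Θ ⌋ × (∀ i → ⌊ Θ ⌋ ⊆ ⌊ premises i ⌋ → P i)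
      ; full     = [] , (λ ()) , λ _ _ → tt
      ; ∩-closed = λ (Θ , id⊨Θ , p) (Θ′ , id⊨Θ′ , p′) →
          Θ ++ Θ′ ,
          (λ e∈ → [ id⊨Θ , id⊨Θ′ ]′ (∈-++⁻ Θ e∈)) ,
          λ i Θ⊆ → p i (Θ⊆ ∘ ∈-++⁺ˡ) , p′ i (Θ⊆ ∘ ∈-++⁺ʳ Θ)
      ; upward   = λ P⊆Q (Θ , id⊨Θ , p) → Θ , id⊨Θ , λ i Θ⊆ → P⊆Q (p i Θ⊆)
      }

    eventually : ∀ e → (𝒜 ⊨ id) e → (λ i → (ℬ i ⊨ w i) e) ∈ Filter.Large F
    eventually e id⊨e = (e ∷ []) , (λ { (here refl) → id⊨e }) , λ i e∈ → w⊨ i (e∈ (here refl))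

    diagonal : 𝒜 ↪ reducedProduct F ℬ
    diagonal = record
      { to             = λ a i → w i a
      ; isHomomorphism = record
        { cong = λ {a} {b} a≈b → eventually (var a , var b) a≈b
        ; homo = λ o as → Filter.upward F
            (λ {i} eq → Algebra.trans (ℬ i) eq (app-tabulate (ℬ i) o (var ∘ as) (w i)))
            (eventually (var (𝒜.op o as) , app o (Vec.tabulate (var ∘ as)))
                        (𝒜.sym (app-tabulate 𝒜 o (var ∘ as) id)))
        }
      -- If a ≈ b were false in 𝒜 and yet true on a large set determined by Θ,
      -- the index with premises Θ and false equation a ≈ b would contradict
      -- its own countermodel.
      ; injective      = λ {a} {b} (Θ , id⊨Θ , p) → em⇒dne em₀ λ a≉b →
          let i = (Θ , λ {e} → id⊨Θ {e}) , ((var a , var b) , a≉b) in w⊭ i (p i id)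
      }

  maltsev : 𝒜 ∈ Member 𝐊
  maltsev = Quasivariety.subalgebra-closed 𝐊 diagonal
    (Quasivariety.reducedProduct-closed 𝐊 F ℬ (λ i → proj₁ (proj₂ (cm i))))

------------------------------------------------------------------------
-- Quotients of the term algebra

-- A set of equations closed under the finitary consequence of 𝐘 is a congruence,
-- since the laws of congruence are themselves finite quasi-equations.
module _ {𝓛 : Signature ℓ} (𝐘 : Quasivariety 𝓛) (θ : Pred (Equation 𝓛 ℕ) ℓ)
         (closed : ∀ {Θ e} → ⌊ Θ ⌋ ⊆ θ → ⌊ Θ ⌋ ⊨[ Member 𝐘 ] e → e ∈ θ) where
  private
    θ-refl : ∀ {t} → (t , t) ∈ θ
    θ-refl = closed {Θ = []} (λ ()) (λ 𝒜 _ _ _ → Algebra.refl 𝒜)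

    θ-sym : ∀ {s t} → (s , t) ∈ θ → (t , s) ∈ θ
    θ-sym {s} {t} s≈t =
      closed {Θ = (s , t) ∷ []} (λ { (here refl) → s≈t })
             (λ 𝒜 _ _ v⊨ → Algebra.sym 𝒜 (v⊨ (here refl)))

    θ-trans : ∀ {s t u} → (s , t) ∈ θ → (t , u) ∈ θ → (s , u) ∈ θ
    θ-trans {s} {t} {u} s≈t t≈u =
      closed {Θ = (s , t) ∷ (t , u) ∷ []}
             (λ { (here refl) → s≈t ; (there (here refl)) → t≈u })
             (λ 𝒜 _ _ v⊨ → Algebra.trans 𝒜 (v⊨ (here refl)) (v⊨ (there (here refl))))

    θ-app : ∀ o {ss ts : Fin (arity 𝓛 o) → Formula 𝓛} → (∀ k → (ss k , ts k) ∈ θ) →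
            (app o (Vec.tabulate ss) , app o (Vec.tabulate ts)) ∈ θ
    θ-app o {ss} {ts} s≈t =
      closed {Θ = List.tabulate (λ k → ss k , ts k)} ⊆θ λ 𝒜 _ v v⊨ →
        let module 𝒜 = Algebra 𝒜 in
        𝒜.trans (app-tabulate 𝒜 o ss v)
          (𝒜.trans (𝒜.op-cong o (λ k → v⊨ (∈-tabulate⁺ k)))
                    (𝒜.sym (app-tabulate 𝒜 o ts v)))
      where
      ⊆θ : ⌊ List.tabulate (λ k → ss k , ts k) ⌋ ⊆ θ
      ⊆θ e∈ with ∈-tabulate⁻ e∈
      ... | k , refl = s≈t k

  termQuotient : Algebra 𝓛
  termQuotient = record
    { setoid = record
      { Carrier       = Formula 𝓛
      ; _≈_           = λ s t → (s , t) ∈ θ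
      ; isEquivalence = record { refl = θ-refl ; sym = θ-sym ; trans = θ-trans }
      }
    ; op         = λ o ts → app o (Vec.tabulate ts)
    ; op-cong    = θ-app
    ; inhabitant = var 0
    }

  mutual
    ⟦⟧-termQuotient : (t : Term 𝓛 X) (σ : X → Formula 𝓛) → ⟦ termQuotient ⟧ t σ ≡ t [ σ ]
    ⟦⟧-termQuotient (var x)    σ = refl
    ⟦⟧-termQuotient (app o ts) σ = cong (app o) (⟦⟧*-termQuotient ts σ)

    ⟦⟧*-termQuotient : (ts : Vec (Term 𝓛 X) n) (σ : X → Formula 𝓛) →
                       Vec.tabulate (⟦ termQuotient ⟧* ts σ) ≡ ts [ σ ]*
    ⟦⟧*-termQuotient []       σ = refl
    ⟦⟧*-termQuotient (t ∷ ts) σ = cong₂ _∷_ (⟦⟧-termQuotient t σ) (⟦⟧*-termQuotient ts σ)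

  ⊨-termQuotient : (e : Equation 𝓛 X) (σ : X → Formula 𝓛) →
                   (termQuotient ⊨ σ) e ⇔ (e [ σ ]ₑ ∈ θ)
  ⊨-termQuotient (s , t) σ
    rewrite ⟦⟧-termQuotient s σ | ⟦⟧-termQuotient t σ = mk⇔ id id

  -- An instance of a quasi-equation of 𝐘 is one again, so closure of θ under
  -- consequence says that the quotient satisfies it.
  termQuotient∈𝐘 : ExcludedMiddle (lsuc ℓ) → termQuotient ∈ Member 𝐘
  termQuotient∈𝐘 em = maltsev em 𝐘 termQuotient λ Θ e Θ⊨e σ σ⊨Θ →
    from (⊨-termQuotient e σ)
      (closed (Θσ⊆θ Θ σ σ⊨Θ) λ 𝒜 𝒜∈𝐘 v v⊨ → from (⊨-subst 𝒜 e σ v)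
        (Θ⊨e 𝒜 𝒜∈𝐘 _ λ {d} d∈Θ → to (⊨-subst 𝒜 d σ v) (v⊨ (∈-map⁺ (_[ σ ]ₑ) d∈Θ))))
    where
    Θσ⊆θ : ∀ Θ σ → (termQuotient ⊨ˢ σ) ⌊ Θ ⌋ → ⌊ List.map (_[ σ ]ₑ) Θ ⌋ ⊆ θ
    Θσ⊆θ Θ σ σ⊨Θ e∈ with ∈-map⁻ (_[ σ ]ₑ) e∈
    ... | d , d∈Θ , refl = to (⊨-termQuotient d σ) (σ⊨Θ d∈Θ)

------------------------------------------------------------------------
-- Truth sets of algebras

module _ {𝓛 : Signature ℓ} (μ : List (Equation 𝓛 (Fin 1))) where

  -- The designated elements of the matrix on 𝒜: with these, satisfying μ(φ) becomes
  -- a property of the value of φ alone.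
  Truth : (𝒜 : Algebra 𝓛) → Pred ∣ 𝒜 ∣ ℓ
  Truth 𝒜 a = ∀ e → e ∈ ⌊ μ ⌋ → (𝒜 ⊨ λ _ → a) e

  module _ (𝒜 : Algebra 𝓛) where

    Truth-cong : ∀ {a b} → Algebra._≈_ 𝒜 a b → a ∈ Truth 𝒜 → b ∈ Truth 𝒜
    Truth-cong a≈b a∈T e e∈μ = ⊨-cong 𝒜 e (λ _ → a≈b) (a∈T e e∈μ)

    ⊨μ⇔Truth : ∀ φ (v : ℕ → ∣ 𝒜 ∣) → (𝒜 ⊨ˢ v) (μ ⟪ φ ⟫) ⇔ (⟦ 𝒜 ⟧ φ v ∈ Truth 𝒜)
    ⊨μ⇔Truth φ v = mk⇔ ⊨μ⇒Truth Truth⇒⊨μ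
      where
      ⊨μ⇒Truth : (𝒜 ⊨ˢ v) (μ ⟪ φ ⟫) → ⟦ 𝒜 ⟧ φ v ∈ Truth 𝒜
      ⊨μ⇒Truth v⊨μφ e e∈μ =
        to (⊨-subst 𝒜 e _ v) (v⊨μφ (∈-map⁺ (_[ (λ _ → φ) ]ₑ) e∈μ))

      Truth⇒⊨μ : ⟦ 𝒜 ⟧ φ v ∈ Truth 𝒜 → (𝒜 ⊨ˢ v) (μ ⟪ φ ⟫)
      Truth⇒⊨μ φ∈T e∈μφ with ∈-map⁻ (_[ (λ _ → φ) ]ₑ) e∈μφ
      ... | d , d∈μ , refl = from (⊨-subst 𝒜 d _ v) (φ∈T d d∈μ)

    ⊨μˢ⇔Truth : ∀ Γ (v : ℕ → ∣ 𝒜 ∣) →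
      (𝒜 ⊨ˢ v) (μ ⟪ Γ ⟫ˢ) ⇔ (∀ ψ → ψ ∈ Γ → ⟦ 𝒜 ⟧ ψ v ∈ Truth 𝒜)
    ⊨μˢ⇔Truth Γ v = mk⇔ ⊨μˢ⇒Truth Truth⇒⊨μˢ
      where
      ⊨μˢ⇒Truth : (𝒜 ⊨ˢ v) (μ ⟪ Γ ⟫ˢ) → ∀ ψ → ψ ∈ Γ → ⟦ 𝒜 ⟧ ψ v ∈ Truth 𝒜
      ⊨μˢ⇒Truth v⊨μΓ ψ ψ∈Γ = to (⊨μ⇔Truth ψ v) (λ e∈μψ → v⊨μΓ (ψ , ψ∈Γ , e∈μψ))

      Truth⇒⊨μˢ : (∀ ψ → ψ ∈ Γ → ⟦ 𝒜 ⟧ ψ v ∈ Truth 𝒜) → (𝒜 ⊨ˢ v) (μ ⟪ Γ ⟫ˢ)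
      Truth⇒⊨μˢ Γ∈T (ψ , ψ∈Γ , e∈μψ) = from (⊨μ⇔Truth ψ v) (Γ∈T ψ ψ∈Γ) e∈μψ

    Truth-subst : ∀ φ (σ : ℕ → Formula 𝓛) (v : ℕ → ∣ 𝒜 ∣) →
      (⟦ 𝒜 ⟧ (φ [ σ ]) v ∈ Truth 𝒜) ⇔ (⟦ 𝒜 ⟧ φ (λ q → ⟦ 𝒜 ⟧ (σ q) v) ∈ Truth 𝒜)
    Truth-subst φ σ v = mk⇔ (Truth-cong (⟦⟧-subst 𝒜 φ σ v))
                            (Truth-cong (Algebra.sym 𝒜 (⟦⟧-subst 𝒜 φ σ v)))

  Truth-embedding : ∀ {ℬ 𝒜 : Algebra 𝓛} (h : ℬ ↪ 𝒜) {b} →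
                    (b ∈ Truth ℬ) ⇔ (_↪_.to h b ∈ Truth 𝒜)
  Truth-embedding h = mk⇔ (λ b∈T e e∈μ → to (⊨-embedding h e _) (b∈T e e∈μ))
                          (λ hb∈T e e∈μ → from (⊨-embedding h e _) (hb∈T e e∈μ))

  Truth-eval : ∀ {ℬ 𝒜 : Algebra 𝓛} (h : ℬ ↪ 𝒜) φ (v : ℕ → ∣ ℬ ∣) →
               (⟦ ℬ ⟧ φ v ∈ Truth ℬ) ⇔ (⟦ 𝒜 ⟧ φ (_↪_.to h ∘ v) ∈ Truth 𝒜)
  Truth-eval {𝒜 = 𝒜} h φ v = mk⇔
    (Truth-cong 𝒜 φv≈ ∘ to (Truth-embedding h))
    (from (Truth-embedding h) ∘ Truth-cong 𝒜 (Algebra.sym 𝒜 φv≈))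
    where φv≈ = ⟦⟧-hom (_↪_.isHomomorphism h) φ v

  module _ {I : Set ℓ} (F : Filter I) (𝒜 : I → Algebra 𝓛) where
    open Filter F

    Truth-reducedProduct : ∀ φ (v : ℕ → ∣ reducedProduct F 𝒜 ∣) →
      (⟦ reducedProduct F 𝒜 ⟧ φ v ∈ Truth (reducedProduct F 𝒜)) ⇔
      ((λ i → ⟦ 𝒜 i ⟧ φ (λ p → v p i) ∈ Truth (𝒜 i)) ∈ Large)
    Truth-reducedProduct φ v = mk⇔
      (λ φ∈T → upward (λ {i} h → Truth-cong (𝒜 i) (⟦⟧-reducedProduct F 𝒜 φ v i) (λ _ e∈μ → h e∈μ))
                 (large-all F 𝒜 μ (λ {e} e∈μ → to (⊨-reducedProduct F 𝒜 e _) (φ∈T e e∈μ))))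
      (λ large e e∈μ → from (⊨-reducedProduct F 𝒜 e _)
         (upward (λ {i} h → Truth-cong (𝒜 i)
                    (Algebra.sym (𝒜 i) (⟦⟧-reducedProduct F 𝒜 φ v i)) h e e∈μ) large))

------------------------------------------------------------------------
-- Logics

module _ {𝓛 : Signature ℓ} (T : Logic 𝓛) where
  open Logic T

  weaken : ∀ {Γ Γ′ φ} → Γ ⊆ Γ′ → Γ ⊢ φ → Γ′ ⊢ φ
  weaken Γ⊆Γ′ = cut (reflexive ∘ Γ⊆Γ′)

module _ {𝓛 : Signature ℓ} (_⊩_ : Consequence 𝓛)
         (⊩-reflexive  : ∀ {Γ φ} → φ ∈ Γ → Γ ⊩ φ)
         (⊩-cut        : ∀ {Γ Γ′ φ} → (∀ {ψ} → ψ ∈ Γ′ → Γ ⊩ ψ) → Γ′ ⊩ φ → Γ ⊩ φ)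
         (⊩-structural : ∀ {Γ φ} (σ : ℕ → Formula 𝓛) → Γ ⊩ φ → (Γ [ σ ]ˢ) ⊩ (φ [ σ ]))
         where
  private
    ⊩-weaken : ∀ {Γ Γ′ φ} → Γ ⊆ Γ′ → Γ ⊩ φ → Γ′ ⊩ φ
    ⊩-weaken Γ⊆Γ′ = ⊩-cut (⊩-reflexive ∘ Γ⊆Γ′)

    _⊩₀_ : Consequence 𝓛
    Γ ⊩₀ φ = ∃ λ Γ₀ → ⌊ Γ₀ ⌋ ⊆ Γ × ⌊ Γ₀ ⌋ ⊩ φ

    -- Finitely many conclusions share one finite set of premises.
    join : ∀ {Γ} Γ′ → (∀ {ψ} → ψ ∈ ⌊ Γ′ ⌋ → Γ ⊩₀ ψ) →
           ∃ λ Γ₀ → ⌊ Γ₀ ⌋ ⊆ Γ × (∀ {ψ} → ψ ∈ ⌊ Γ′ ⌋ → ⌊ Γ₀ ⌋ ⊩ ψ)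
    join []       Γ⊩₀ = [] , (λ ()) , λ ()
    join (ψ ∷ Γ′) Γ⊩₀ with Γ⊩₀ (here refl) | join Γ′ (Γ⊩₀ ∘ there)
    ... | Γ₁ , Γ₁⊆Γ , Γ₁⊩ψ | Γ₂ , Γ₂⊆Γ , Γ₂⊩Γ′ =
      Γ₁ ++ Γ₂ ,
      (λ χ∈ → [ Γ₁⊆Γ , Γ₂⊆Γ ]′ (∈-++⁻ Γ₁ χ∈)) ,
      λ { (here refl) → ⊩-weaken ∈-++⁺ˡ Γ₁⊩ψ
        ; (there χ∈Γ′) → ⊩-weaken (∈-++⁺ʳ Γ₁) (Γ₂⊩Γ′ χ∈Γ′) }

  -- The greatest finitary logic below _⊩_.  An intersection of finitary logics, or
  -- the consequence of a class of algebras, need not be finitary itself.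
  finitaryPart : Logic 𝓛
  finitaryPart = record
    { _⊢_        = _⊩₀_
    ; reflexive  = λ {_} {φ} φ∈Γ → φ ∷ [] , (λ { (here refl) → φ∈Γ }) , ⊩-reflexive (here refl)
    ; cut        = λ Γ⊩₀Γ′ (Γ′₀ , Γ′₀⊆Γ′ , Γ′₀⊩φ) →
        let Γ₀ , Γ₀⊆Γ , Γ₀⊩Γ′₀ = join Γ′₀ (Γ⊩₀Γ′ ∘ Γ′₀⊆Γ′) in
        Γ₀ , Γ₀⊆Γ , ⊩-cut Γ₀⊩Γ′₀ Γ′₀⊩φ
    ; finitary   = λ (Γ₀ , Γ₀⊆Γ , Γ₀⊩φ) → Γ₀ , Γ₀⊆Γ , Γ₀ , id , Γ₀⊩φ
    ; structural = λ σ (Γ₀ , Γ₀⊆Γ , Γ₀⊩φ) →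
        List.map (_[ σ ]) Γ₀ ,
        (λ ψ∈ → let χ , χ∈Γ₀ , ψ≡χσ = ∈-map⁻ (_[ σ ]) ψ∈ in χ , Γ₀⊆Γ χ∈Γ₀ , sym ψ≡χσ) ,
        ⊩-weaken (λ { (χ , χ∈Γ₀ , refl) → ∈-map⁺ (_[ σ ]) χ∈Γ₀ }) (⊩-structural σ Γ₀⊩φ)
    }

module _ {𝓛 : Signature ℓ} (em : ExcludedMiddle (lsuc (lsuc ℓ)))
         {I : Set (lsuc (lsuc ℓ))} (T : I → Logic 𝓛) where
  private
    Common : Pred (Formula 𝓛) ℓ → Formula 𝓛 → Set (lsuc (lsuc ℓ))
    Common Γ φ = ∀ i → Logic._⊢_ (T i) Γ φ

    _⊩_ : Consequence 𝓛
    Γ ⊩ φ = Squash _ (em {Common Γ φ})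

  meet : Logic 𝓛
  meet = finitaryPart _⊩_
    (λ φ∈Γ → squash em (λ i → Logic.reflexive (T i) φ∈Γ))
    (λ Γ⊩Γ′ Γ′⊩φ → squash em λ i →
       Logic.cut (T i) (λ ψ∈Γ′ → unsquash em (Γ⊩Γ′ ψ∈Γ′) i) (unsquash em Γ′⊩φ i))
    (λ σ Γ⊩φ → squash em λ i → Logic.structural (T i) σ (unsquash em Γ⊩φ i))

  meet-lower : ∀ i → ⊢-of meet ⇒ ⊢-of (T i)
  meet-lower i (Γ₀ , Γ₀⊆Γ , Γ₀⊩φ) = weaken (T i) Γ₀⊆Γ (unsquash em Γ₀⊩φ i)

  meet-intro : ∀ {Γ φ} Γ₀ → ⌊ Γ₀ ⌋ ⊆ Γ → (∀ i → Logic._⊢_ (T i) ⌊ Γ₀ ⌋ φ) →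
               Logic._⊢_ meet Γ φ
  meet-intro Γ₀ Γ₀⊆Γ Γ₀⊢φ = Γ₀ , Γ₀⊆Γ , squash em Γ₀⊢φ

------------------------------------------------------------------------
-- The lattice of PAt-f-logics

module _ {𝓛 : Signature ℓ} (em : ExcludedMiddle (lsuc (lsuc ℓ)))
         (L : Logic 𝓛) (f : Term 𝓛 (Fin 1)) where
  private
    f[p] : ℕ → Formula 𝓛
    f[p] q = f ⟨ var q ⟩

  Λᶠ-infima : {I : Set (lsuc (lsuc ℓ))} (xs : I → ∃ (IsPAtLogic L f)) →
              ∃ (IsInfimum (Λᶠ L f) xs)
  Λᶠ-infima {I} xs = ((f ᶠ) (⊢-of M) , M , L⇒M , id , id) , M≤xs , greatest
    where
    T : I → Logic 𝓛
    T i = proj₁ (proj₂ (xs i))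

    L⇒T : ∀ i → ⊢-of L ⇒ ⊢-of (T i)
    L⇒T i = proj₁ (proj₂ (proj₂ (xs i)))

    xs⇔ : ∀ i → proj₁ (xs i) ⇔₂ (f ᶠ) (⊢-of (T i))
    xs⇔ i = proj₂ (proj₂ (proj₂ (xs i)))

    M : Logic 𝓛
    M = meet em T

    L⇒M : ⊢-of L ⇒ ⊢-of M
    L⇒M Γ⊢φ = let Γ₀ , Γ₀⊆Γ , Γ₀⊢φ = Logic.finitary L Γ⊢φ in
      meet-intro em T Γ₀ Γ₀⊆Γ (λ i → L⇒T i Γ₀⊢φ)

    M≤xs : ∀ i → (f ᶠ) (⊢-of M) ⇒ proj₁ (xs i)
    M≤xs i Γ⊢φ = proj₂ (xs⇔ i) (meet-lower em T i Γ⊢φ)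

    -- A derivation in S uses a finite part Γ₀ of Γ[f(p)/p].  To pass through t it has
    -- to come from a set of formulas before substitution: Γ₁ collects those
    -- members of Γ that are sent into Γ₀.
    greatest : ∀ t → (∀ i → proj₁ t ⇒ proj₁ (xs i)) → proj₁ t ⇒ (f ᶠ) (⊢-of M)
    greatest (t , S , _ , t⇒Sᶠ , Sᶠ⇒t) t≤xs {Γ} {φ} Γtφ =
      let Γ₀ , Γ₀⊆Γf , Γ₀⊢φf = Logic.finitary S (t⇒Sᶠ Γtφ)
          Γ₁ : Pred (Formula 𝓛) ℓ
          Γ₁ χ = χ ∈ Γ × χ [ f[p] ] ∈ ⌊ Γ₀ ⌋
          Γ₀⊆Γ₁f : ⌊ Γ₀ ⌋ ⊆ (Γ₁ [ f[p] ]ˢ)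
          Γ₀⊆Γ₁f ψ∈Γ₀ = let χ , χ∈Γ , χf≡ψ = Γ₀⊆Γf ψ∈Γ₀ in
            χ , (χ∈Γ , subst (_∈ ⌊ Γ₀ ⌋) (sym χf≡ψ) ψ∈Γ₀) , χf≡ψ
          Γ₁tφ = Sᶠ⇒t {Γ₁} {φ} (weaken S Γ₀⊆Γ₁f Γ₀⊢φf)
      in meet-intro em T Γ₀ Γ₀⊆Γf λ i →
           weaken (T i) (λ { (χ , (_ , χf∈Γ₀) , refl) → χf∈Γ₀ })
                  (proj₁ (xs⇔ i) (t≤xs i Γ₁tφ))

------------------------------------------------------------------------
-- Models of a logic

module _ {𝓛 : Signature ℓ} (𝐘 : Quasivariety 𝓛) (μ : List (Equation 𝓛 (Fin 1)))
         (T : Logic 𝓛) where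
  open Logic T

  Validates : Algebra 𝓛 → Set (lsuc ℓ)
  Validates 𝒜 = ∀ {Γ φ} → Γ ⊢ φ → ∀ v →
                (∀ ψ → ψ ∈ Γ → ⟦ 𝒜 ⟧ ψ v ∈ Truth μ 𝒜) → ⟦ 𝒜 ⟧ φ v ∈ Truth μ 𝒜

  Validates-subalgebra : ∀ {𝒜 ℬ} → ℬ ↪ 𝒜 → Validates 𝒜 → Validates ℬ
  Validates-subalgebra h val {_} {φ} Γ⊢φ v Γ∈T =
    from (Truth-eval μ h φ v) (val Γ⊢φ _ λ ψ ψ∈Γ → to (Truth-eval μ h ψ v) (Γ∈T ψ ψ∈Γ))

  -- The premises used are finitely many, so if each is true in almost all factors
  -- then almost all factors make them true together.
  Validates-reducedProduct : ∀ {I : Set ℓ} (F : Filter I) (𝒜 : I → Algebra 𝓛) →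
    (∀ i → Validates (𝒜 i)) → Validates (reducedProduct F 𝒜)
  Validates-reducedProduct F 𝒜 val {_} {φ} Γ⊢φ v Γ∈T with finitary Γ⊢φ
  ... | Γ₀ , Γ₀⊆Γ , Γ₀⊢φ =
    from (Truth-reducedProduct μ F 𝒜 φ v)
      (Filter.upward F (λ {i} Γ₀∈T → val i Γ₀⊢φ _ λ ψ ψ∈Γ₀ → Γ₀∈T ψ∈Γ₀)
        (large-all F 𝒜 Γ₀ λ {ψ} ψ∈Γ₀ →
          to (Truth-reducedProduct μ F 𝒜 ψ v) (Γ∈T ψ (Γ₀⊆Γ ψ∈Γ₀))))

  Models : Quasivariety 𝓛
  Models = record
    { Member                = λ 𝒜 → 𝒜 ∈ Member 𝐘 × Validates 𝒜
    ; iso-closed            = λ ℬ≅𝒜 (𝒜∈𝐘 , val) →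
        𝐘.iso-closed ℬ≅𝒜 𝒜∈𝐘 , Validates-subalgebra (_≅_.embedding ℬ≅𝒜) val
    ; subalgebra-closed     = λ ℬ↪𝒜 (𝒜∈𝐘 , val) →
        𝐘.subalgebra-closed ℬ↪𝒜 𝒜∈𝐘 , Validates-subalgebra ℬ↪𝒜 val
    ; reducedProduct-closed = λ F 𝒜 𝒜∈ →
        𝐘.reducedProduct-closed F 𝒜 (proj₁ ∘ 𝒜∈) ,
        Validates-reducedProduct F 𝒜 (λ i → proj₂ (𝒜∈ i))
    }
    where module 𝐘 = Quasivariety 𝐘

------------------------------------------------------------------------
-- Core elements

module _ (𝒜 : Algebra 𝓛) (f : Term 𝓛 (Fin 1)) where
  private module 𝒜 = Algebra 𝒜

  Core-cong : ∀ {a b} → a 𝒜.≈ b → a ∈ Core 𝒜 f → b ∈ Core 𝒜 f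
  Core-cong a≈b fa≈a =
    𝒜.trans (⟦⟧-cong 𝒜 f (λ _ → 𝒜.sym a≈b)) (𝒜.trans fa≈a a≈b)

  ≼-refl : 𝒜 ≼[ f ] 𝒜
  ≼-refl = idₑ , (λ a∈C → _ , a∈C , 𝒜.refl) , λ (_ , b∈C , b≈a) → Core-cong b≈a b∈C
    where
    idₑ : 𝒜 ↪ 𝒜
    idₑ = record
      { to             = id
      ; isHomomorphism = record { cong = id ; homo = λ _ _ → 𝒜.refl }
      ; injective      = id
      }

  -- f fixes the values of v, so substituting f(q) for q changes no value.
  Truth-core : ∀ μ φ (v : ℕ → ∣ 𝒜 ∣) → (∀ q → v q ∈ Core 𝒜 f) →
    (⟦ 𝒜 ⟧ (φ [ (λ q → f ⟨ var q ⟩) ]) v ∈ Truth μ 𝒜) ⇔ (⟦ 𝒜 ⟧ φ v ∈ Truth μ 𝒜)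
  Truth-core μ φ v v∈C = mk⇔ (Truth-cong μ 𝒜 φf≈φ) (Truth-cong μ 𝒜 (𝒜.sym φf≈φ))
    where
    φf≈φ = 𝒜.trans (⟦⟧-subst 𝒜 φ (λ q → f ⟨ var q ⟩) v)
             (⟦⟧-cong 𝒜 φ λ q → 𝒜.trans (⟦⟧-subst 𝒜 f _ v) (v∈C q))

module _ {𝓛 : Signature ℓ} (𝐘 : Quasivariety 𝓛) (f : Term 𝓛 (Fin 1))
         (idem : IsIdempotent 𝐘 f) (𝒜 : Algebra 𝓛) (𝒜∈𝐘 : 𝒜 ∈ Member 𝐘) where
  private module 𝒜 = Algebra 𝒜

  f-value∈Core : ∀ a → ⟦ 𝒜 ⟧ f (λ _ → a) ∈ Core 𝒜 f
  f-value∈Core a = 𝒜.trans (⟦⟧-cong 𝒜 f (λ _ → 𝒜.sym fp≈fa))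
                     (𝒜.trans (𝒜.sym (⟦⟧-subst 𝒜 f _ v))
                       (𝒜.trans (idem 𝒜 𝒜∈𝐘 v (λ ())) fp≈fa))
    where
    v : ℕ → ∣ 𝒜 ∣
    v _ = a
    fp≈fa : ⟦ 𝒜 ⟧ (f ⟨ var 0 ⟩) v 𝒜.≈ ⟦ 𝒜 ⟧ f (λ _ → a)
    fp≈fa = ⟦⟧-subst 𝒜 f (λ _ → var 0) v

  private
    C : Set ℓ
    C = ∃ (Core 𝒜 f)

    value : Term 𝓛 C → ∣ 𝒜 ∣
    value t = ⟦ 𝒜 ⟧ t proj₁

  -- The subalgebra generated by the core.  Terms over the core, compared by value,
  -- keep track of how each element is generated.
  coreSubalgebra : Algebra 𝓛
  coreSubalgebra = record
    { setoid     = On.setoid 𝒜.setoid value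
    ; op         = λ o ts → app o (Vec.tabulate ts)
    ; op-cong    = λ o {ss} {ts} ss≈ts →
        𝒜.trans (app-tabulate 𝒜 o ss proj₁)
          (𝒜.trans (𝒜.op-cong o ss≈ts) (𝒜.sym (app-tabulate 𝒜 o ts proj₁)))
    ; inhabitant = var (_ , f-value∈Core 𝒜.inhabitant)
    }

  coreSubalgebra↪ : coreSubalgebra ↪ 𝒜
  coreSubalgebra↪ = record
    { to             = value
    ; isHomomorphism = record { cong = id ; homo = λ o ts → app-tabulate 𝒜 o ts proj₁ }
    ; injective      = id
    }

  coreSubalgebra≼ : coreSubalgebra ≼[ f ] 𝒜
  coreSubalgebra≼ = coreSubalgebra↪ ,
    (λ {a} a∈C → var (a , a∈C) , 𝒜.trans (value-f (var (a , a∈C))) a∈C , 𝒜.refl) ,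
    λ (b , b∈C , b≈a) → Core-cong 𝒜 f b≈a (𝒜.trans (𝒜.sym (value-f b)) b∈C)
    where
    value-f : ∀ b → value (⟦ coreSubalgebra ⟧ f (λ _ → b)) 𝒜.≈ ⟦ 𝒜 ⟧ f (λ _ → value b)
    value-f b = ⟦⟧-hom (_↪_.isHomomorphism coreSubalgebra↪) f (λ _ → b)

  module _ (em : ExcludedMiddle ℓ) (μ : List (Equation 𝓛 (Fin 1))) (T : Logic 𝓛)
           (𝒜⊨T : ∀ {Γ φ} → (f ᶠ) (⊢-of T) Γ φ → _⊨ᶠ_ 𝐘 μ f 𝒜 (Γ , φ)) where
    open Logic T

    -- The values of v are terms over the core.  Naming the core elements that occur
    -- in the finitely many relevant formulas turns v into a substitution σ
    -- followed by an assignment w into the core.  Structurality gives the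
    -- inference for σ, and once more for f, which is what 𝒜⊨T requires.
    coreSubalgebra-validates : Validates 𝐘 μ T coreSubalgebra
    coreSubalgebra-validates {_} {φ} Γ⊢φ v Γ∈T with finitary Γ⊢φ
    ... | Γ₀ , Γ₀⊆Γ , Γ₀⊢φ =
      from (Truth-eval μ coreSubalgebra↪ φ v)
        (Truth-cong μ 𝒜 (ψσ≈ψ (here refl))
          (to (⊨μ⇔Truth μ 𝒜 (φ [ σ ]) w)
            (𝒜⊨T (structural f[p] (structural σ Γ₀⊢φ)) w (proj₂ ∘ ρ)
              (from (⊨μˢ⇔Truth μ 𝒜 _ w) Γ₀σ∈T))))
      where
      naming = enumerate {X = C} (λ _ _ → em) (_ , f-value∈Core 𝒜.inhabitant)
                 (concatMap (λ ψ → vars (ψ [ v ])) (φ ∷ Γ₀))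
      ι = proj₁ naming
      ρ = proj₁ (proj₂ naming)

      f[p] : ℕ → Formula 𝓛
      f[p] q = f ⟨ var q ⟩

      σ : ℕ → Formula 𝓛
      σ q = v q [ var ∘ ι ]

      w : ℕ → ∣ 𝒜 ∣
      w = proj₁ ∘ ρ

      ψσ≈ψ : ∀ {ψ} → ψ ∈ ⌊ φ ∷ Γ₀ ⌋ → ⟦ 𝒜 ⟧ (ψ [ σ ]) w 𝒜.≈ ⟦ 𝒜 ⟧ ψ (value ∘ v)
      ψσ≈ψ {ψ} ψ∈ = begin
        ⟦ 𝒜 ⟧ (ψ [ σ ]) w                      ≈⟨ ⟦⟧-subst 𝒜 ψ σ w ⟩
        ⟦ 𝒜 ⟧ ψ (λ q → ⟦ 𝒜 ⟧ (σ q) w)          ≈⟨ ⟦⟧-cong 𝒜 ψ (λ q → ⟦⟧-subst 𝒜 (v q) (var ∘ ι) w) ⟩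
        ⟦ 𝒜 ⟧ ψ (λ q → ⟦ 𝒜 ⟧ (v q) (w ∘ ι))    ≈⟨ ⟦⟧-subst 𝒜 ψ v (w ∘ ι) ⟨
        ⟦ 𝒜 ⟧ (ψ [ v ]) (w ∘ ι)                ≈⟨ ⟦⟧-agree 𝒜 (ψ [ v ]) (λ x∈ → 𝒜.reflexive
                                                    (cong proj₁ (proj₂ (proj₂ naming)
                                                      (∈-concatMap⁺ _ (lose ψ∈ x∈))))) ⟩
        ⟦ 𝒜 ⟧ (ψ [ v ]) proj₁                  ≈⟨ ⟦⟧-subst 𝒜 ψ v proj₁ ⟩
        ⟦ 𝒜 ⟧ ψ (value ∘ v)                    ∎
        where open ≈-Reasoning 𝒜.setoid

      Γ₀σ∈T : ∀ ψ → ψ ∈ (⌊ Γ₀ ⌋ [ σ ]ˢ) → ⟦ 𝒜 ⟧ ψ w ∈ Truth μ 𝒜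
      Γ₀σ∈T ψ (χ , χ∈Γ₀ , refl) =
        Truth-cong μ 𝒜 (𝒜.sym (ψσ≈ψ (there χ∈Γ₀)))
          (to (Truth-eval μ coreSubalgebra↪ χ v) (Γ∈T χ (Γ₀⊆Γ χ∈Γ₀)))

------------------------------------------------------------------------
-- QVarᶠ yields PAt-f-quasivarieties

module _ {𝓛 : Signature ℓ} (em : ExcludedMiddle ℓ) (𝐘 : Quasivariety 𝓛)
         (μ : List (Equation 𝓛 (Fin 1))) (f : Term 𝓛 (Fin 1)) (idem : IsIdempotent 𝐘 f)
         (T : Logic 𝓛) where

  QVarᶠ-Models : ∀ {s} → s ⇔₂ (f ᶠ) (⊢-of T) →
                 QVarᶠ 𝐘 μ f s ≐ _↑ 𝐘 f (Member (Models 𝐘 μ T))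
  QVarᶠ-Models {s} (s⇒Tᶠ , Tᶠ⇒s) = QVarᶠ⊆ , ⊆QVarᶠ
    where
    QVarᶠ⊆ : QVarᶠ 𝐘 μ f s ⊆ _↑ 𝐘 f (Member (Models 𝐘 μ T))
    QVarᶠ⊆ {𝒜} (𝒜∈𝐘 , 𝒜⊨s) =
      𝒜∈𝐘 , ℬ ,
      (Quasivariety.subalgebra-closed 𝐘 (coreSubalgebra↪ 𝐘 f idem 𝒜 𝒜∈𝐘) 𝒜∈𝐘 ,
       coreSubalgebra-validates 𝐘 f idem 𝒜 𝒜∈𝐘 em μ T
         (λ {Γ} {φ} Γ⊢φ → 𝒜⊨s (Tᶠ⇒s {Γ} {φ} Γ⊢φ))) ,
      coreSubalgebra≼ 𝐘 f idem 𝒜 𝒜∈𝐘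
      where ℬ = coreSubalgebra 𝐘 f idem 𝒜 𝒜∈𝐘

    ⊆QVarᶠ : _↑ 𝐘 f (Member (Models 𝐘 μ T)) ⊆ QVarᶠ 𝐘 μ f s
    ⊆QVarᶠ {𝒜} (𝒜∈𝐘 , ℬ , (_ , ℬ⊨T) , h , 𝒜ᶠ⊆ℬᶠ , _) = 𝒜∈𝐘 , 𝒜⊨s
      where
      module 𝒜 = Algebra 𝒜
      𝒜⊨s : ∀ {Γ φ} → s Γ φ → _⊨ᶠ_ 𝐘 μ f 𝒜 (Γ , φ)
      𝒜⊨s {Γ} {φ} Γsφ v v∈C v⊨Γ =
        from (⊨μ⇔Truth μ 𝒜 φ v)
          (to (lifted φ) (ℬ⊨T (s⇒Tᶠ Γsφ) u λ { _ (χ , χ∈Γ , refl) →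
            from (lifted χ) (to (⊨μˢ⇔Truth μ 𝒜 Γ v) v⊨Γ χ χ∈Γ) }))
        where
        u : ℕ → ∣ ℬ ∣
        u q = proj₁ (𝒜ᶠ⊆ℬᶠ (v∈C q))
        u∈C : ∀ q → u q ∈ Core ℬ f
        u∈C q = proj₁ (proj₂ (𝒜ᶠ⊆ℬᶠ (v∈C q)))
        hu≈v : ∀ q → _↪_.to h (u q) 𝒜.≈ v q
        hu≈v q = proj₂ (proj₂ (𝒜ᶠ⊆ℬᶠ (v∈C q)))

        lifted : ∀ χ → (⟦ ℬ ⟧ (χ [ (λ q → f ⟨ var q ⟩) ]) u ∈ Truth μ ℬ) ⇔
                       (⟦ 𝒜 ⟧ χ v ∈ Truth μ 𝒜)
        lifted χ = mk⇔
          (λ χf∈T → Truth-cong μ 𝒜 (⟦⟧-cong 𝒜 χ hu≈v)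
             (to (Truth-eval μ h χ u) (to (Truth-core ℬ f μ χ u u∈C) χf∈T)))
          (λ χ∈T → from (Truth-core ℬ f μ χ u u∈C) (from (Truth-eval μ h χ u)
             (Truth-cong μ 𝒜 (⟦⟧-cong 𝒜 χ (𝒜.sym ∘ hu≈v)) χ∈T)))

------------------------------------------------------------------------
-- Algebraizability: completeness of logics and recovery of quasivarieties

module _ {𝓛 : Signature ℓ} (em : ExcludedMiddle (lsuc ℓ)) {L : Logic 𝓛}
         {𝐘 : Quasivariety 𝓛} {μ : List (Equation 𝓛 (Fin 1))} {Δ : List (Term 𝓛 (Fin 2))}
         (alg : IsAlgebraizable L 𝐘 μ Δ) where
  open IsAlgebraizable alg

  module _ (T : Logic 𝓛) (L⇒T : ⊢-of L ⇒ ⊢-of T) (Γ : Pred (Formula 𝓛) ℓ) where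
    open Logic T
    private
      -- The Leibniz congruence of the theory axiomatised by Γ.
      θ : Pred (Equation 𝓛 ℕ) ℓ
      θ e = Squash ℓ (em {Γ ⊢ˢ Δ ⟦ e ⟧ₑ})

      θ-closed : ∀ {Θ e} → ⌊ Θ ⌋ ⊆ θ → ⌊ Θ ⌋ ⊨[ Member 𝐘 ] e → e ∈ θ
      θ-closed {Θ} {e} Θ⊆θ Θ⊨e = squash {P = Γ ⊢ˢ Δ ⟦ e ⟧ₑ} em λ ψ∈Δe →
        cut (λ { (d , d∈Θ , χ∈Δd) → unsquash em (Θ⊆θ d∈Θ) χ∈Δd })
            (L⇒T (to (⊨⇔⊢ ⌊ Θ ⌋ e) Θ⊨e ψ∈Δe))

    lindenbaum : Algebra 𝓛
    lindenbaum = termQuotient 𝐘 θ θ-closed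

    lindenbaum-eval : (t : Term 𝓛 X) (σ : X → Formula 𝓛) → ⟦ lindenbaum ⟧ t σ ≡ t [ σ ]
    lindenbaum-eval = ⟦⟧-termQuotient 𝐘 θ θ-closed

    -- Truth of φ in the quotient means that Γ derives Δ[μ(φ)], which is
    -- interderivable with φ.
    lindenbaum-truth : ∀ φ (σ : ℕ → Formula 𝓛) →
      (⟦ lindenbaum ⟧ φ σ ∈ Truth μ lindenbaum) ⇔ (Γ ⊢ φ [ σ ])
    lindenbaum-truth φ σ rewrite lindenbaum-eval φ σ = mk⇔ truth⇒⊢ ⊢⇒truth
      where
      φσ = φ [ σ ]

      truth⇒⊢ : φσ ∈ Truth μ lindenbaum → Γ ⊢ φσ
      truth⇒⊢ φσ∈T = cut Γ⊢Δμ (L⇒T (Δμ⊢φ φσ))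
        where
        Γ⊢Δμ : Γ ⊢ˢ Δ ⟦ μ ⟪ φσ ⟫ ⟧ₑˢ
        Γ⊢Δμ (d , d∈μ , χ∈Δd) with ∈-map⁻ (_[ (λ _ → φσ) ]ₑ) d∈μ
        ... | e , e∈μ , refl =
          unsquash {P = Γ ⊢ˢ Δ ⟦ e [ (λ _ → φσ) ]ₑ ⟧ₑ} em (to (⊨-termQuotient 𝐘 θ θ-closed e _) (φσ∈T e e∈μ)) χ∈Δd

      ⊢⇒truth : Γ ⊢ φσ → φσ ∈ Truth μ lindenbaum
      ⊢⇒truth Γ⊢φσ e e∈μ = from (⊨-termQuotient 𝐘 θ θ-closed e _) (squash {P = Γ ⊢ˢ Δ ⟦ e [ (λ _ → φσ) ]ₑ ⟧ₑ} em λ χ∈Δe →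
        cut (λ { refl → Γ⊢φσ })
            (L⇒T (φ⊢Δμ φσ (_ , ∈-map⁺ (_[ (λ _ → φσ) ]ₑ) e∈μ , χ∈Δe))))

    lindenbaum∈Models : lindenbaum ∈ Member (Models 𝐘 μ T)
    lindenbaum∈Models = termQuotient∈𝐘 𝐘 θ θ-closed em , λ {_} {φ} Γ₁⊢φ σ Γ₁∈T →
      from (lindenbaum-truth φ σ)
        (cut (λ { (χ , χ∈Γ₁ , refl) → to (lindenbaum-truth χ σ) (Γ₁∈T χ χ∈Γ₁) })
             (structural σ Γ₁⊢φ))

  -- The Lindenbaum algebra of Γ[f(p)/p] lies in QVarᶠ t.  If it also lies in QVarᶠ s,
  -- then the core-valued assignment p ↦ f(p), which makes Γ true, makes true
  -- each φ that s infers from Γ; there, this means that T derives φ[f(p)/p].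
  QVarᶠ-reflects : (f : Term 𝓛 (Fin 1)) → IsIdempotent 𝐘 f →
    ∀ {s t} → IsPAtLogic L f t →
    QVarᶠ 𝐘 μ f t ⊆ QVarᶠ 𝐘 μ f s → s ⇒ t
  QVarᶠ-reflects f idem {s} {t} (T , L⇒T , t⇔Tᶠ) Qt⊆Qs {Γ} {φ} Γsφ =
    proj₂ t⇔Tᶠ
      (to (lindenbaum-truth T L⇒T Γf φ f[p])
        (to (⊨μ⇔Truth μ F φ f[p])
          (proj₂ F∈Qs Γsφ f[p] f[p]∈Core
            (from (⊨μˢ⇔Truth μ F Γ f[p]) λ ψ ψ∈Γ →
              from (lindenbaum-truth T L⇒T Γf ψ f[p])
                   (Logic.reflexive T (ψ , ψ∈Γ , refl))))))
    where
    f[p] : ℕ → Formula 𝓛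
    f[p] q = f ⟨ var q ⟩

    Γf : Pred (Formula 𝓛) ℓ
    Γf = Γ [ f[p] ]ˢ

    F : Algebra 𝓛
    F = lindenbaum T L⇒T Γf

    F∈Models = lindenbaum∈Models T L⇒T Γf

    F∈Qs : F ∈ QVarᶠ 𝐘 μ f s
    F∈Qs = Qt⊆Qs (proj₂ (QVarᶠ-Models (lower-em (lsuc ℓ) em) 𝐘 μ f idem T t⇔Tᶠ)
                        (proj₁ F∈Models , F , F∈Models , ≼-refl F f))

    f[p]∈Core : ∀ q → f[p] q ∈ Core F f
    f[p]∈Core q = subst (_∈ Core F f) (lindenbaum-eval T L⇒T Γf f (λ _ → var q))
                        (f-value∈Core 𝐘 f idem F (proj₁ F∈Models) (var q))

  ⊨⇔Δ-true : ∀ e {𝒜} → 𝒜 ∈ Member 𝐘 → ∀ v →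
             (𝒜 ⊨ v) e ⇔ (∀ ψ → ψ ∈ Δ ⟦ e ⟧ₑ → ⟦ 𝒜 ⟧ ψ v ∈ Truth μ 𝒜)
  ⊨⇔Δ-true e {𝒜} 𝒜∈𝐘 v = mk⇔
    (λ v⊨e → to (⊨μˢ⇔Truth μ 𝒜 _ v) (λ d∈ → e⊨μΔ e d∈ 𝒜 𝒜∈𝐘 v (λ { refl → v⊨e })))
    (λ Δe∈T → μΔ⊨e e 𝒜 𝒜∈𝐘 v (from (⊨μˢ⇔Truth μ 𝒜 _ v) Δe∈T))

  module _ (𝐊 : Quasivariety 𝓛) (𝐊⊆𝐘 : Member 𝐊 ⊆ Member 𝐘) where
    private
      _⊩_ : Consequence 𝓛
      Γ ⊩ φ = ∀ 𝒜 → 𝒜 ∈ Member 𝐊 → ∀ v →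
              (∀ ψ → ψ ∈ Γ → ⟦ 𝒜 ⟧ ψ v ∈ Truth μ 𝒜) → ⟦ 𝒜 ⟧ φ v ∈ Truth μ 𝒜

    logicOf : Logic 𝓛
    logicOf = finitaryPart _⊩_
      (λ φ∈Γ _ _ _ Γ∈T → Γ∈T _ φ∈Γ)
      (λ Γ⊩Γ′ Γ′⊩φ 𝒜 𝒜∈𝐊 v Γ∈T → Γ′⊩φ 𝒜 𝒜∈𝐊 v (λ _ ψ∈Γ′ → Γ⊩Γ′ ψ∈Γ′ 𝒜 𝒜∈𝐊 v Γ∈T))
      (λ {_} {φ} σ Γ⊩φ 𝒜 𝒜∈𝐊 v Γσ∈T → from (Truth-subst μ 𝒜 φ σ v)
         (Γ⊩φ 𝒜 𝒜∈𝐊 _ λ ψ ψ∈Γ → to (Truth-subst μ 𝒜 ψ σ v) (Γσ∈T _ (ψ , ψ∈Γ , refl))))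

    logicOf-extends : ⊢-of L ⇒ ⊢-of logicOf
    logicOf-extends {Γ} {φ} Γ⊢φ with Logic.finitary L Γ⊢φ
    ... | Γ₀ , Γ₀⊆Γ , Γ₀⊢φ = Γ₀ , Γ₀⊆Γ , λ 𝒜 𝒜∈𝐊 v Γ₀∈T →
      to (⊨μ⇔Truth μ 𝒜 φ v) λ e∈μφ →
        to (⊢⇔⊨ ⌊ Γ₀ ⌋ φ) Γ₀⊢φ e∈μφ 𝒜 (𝐊⊆𝐘 𝒜∈𝐊) v (from (⊨μˢ⇔Truth μ 𝒜 _ v) Γ₀∈T)

    -- A model satisfies each finite quasi-equation Θ → e of 𝐊, since the logic infers
    -- Δ(e) from Δ[Θ]; Maltsev's theorem then puts it into 𝐊.
    Models-logicOf : Member (Models 𝐘 μ logicOf) ≐ Member 𝐊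
    Models-logicOf = Models⊆𝐊 , λ 𝒜∈𝐊 → 𝐊⊆𝐘 𝒜∈𝐊 , λ (Γ₀ , Γ₀⊆Γ , Γ₀⊩φ) v Γ∈T →
        Γ₀⊩φ _ 𝒜∈𝐊 v (λ ψ ψ∈Γ₀ → Γ∈T ψ (Γ₀⊆Γ ψ∈Γ₀))
      where
      Δ-list : Equation 𝓛 ℕ → List (Formula 𝓛)
      Δ-list (γ , δ) = List.map (_[ γ VF.∷ δ VF.∷ VF.[] ]) Δ

      Models⊆𝐊 : Member (Models 𝐘 μ logicOf) ⊆ Member 𝐊
      Models⊆𝐊 {ℬ} (ℬ∈𝐘 , ℬ⊨) = maltsev em 𝐊 ℬ λ Θ e Θ⊨e v v⊨Θ →
        from (⊨⇔Δ-true e ℬ∈𝐘 v) λ ψ ψ∈Δe →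
          ℬ⊨ {⌊ concatMap Δ-list Θ ⌋} {ψ} (concatMap Δ-list Θ , id , λ 𝒜 𝒜∈𝐊 w ΔΘ∈T →
                to (⊨⇔Δ-true e (𝐊⊆𝐘 𝒜∈𝐊) w) (Θ⊨e 𝒜 𝒜∈𝐊 w λ {d} d∈Θ →
                  from (⊨⇔Δ-true d (𝐊⊆𝐘 𝒜∈𝐊) w) λ χ χ∈Δd →
                    ΔΘ∈T χ (∈-concatMap⁺ Δ-list (lose d∈Θ χ∈Δd)))
                  ψ ψ∈Δe)
             v λ χ χ∈ΔΘ → let d , d∈Θ , χ∈Δd = find (∈-concatMap⁻ Δ-list {xs = Θ} χ∈ΔΘ) in
               to (⊨⇔Δ-true d ℬ∈𝐘 v) (v⊨Θ d∈Θ) χ χ∈Δd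

------------------------------------------------------------------------
-- The dual isomorphism

corollary3p27 :
    ∀ {ℓ : Level} → ExcludedMiddle (lsuc (lsuc ℓ)) →
    (𝓛 : Signature ℓ) (L : Logic 𝓛) (𝐘 : Quasivariety 𝓛)
    (μ : List (Equation 𝓛 (Fin 1))) (Δ : List (Term 𝓛 (Fin 2))) →
    IsAlgebraizable L 𝐘 μ Δ →
    (f : Term 𝓛 (Fin 1)) → IsSelector L f → IsIdempotent 𝐘 f →
    IsCompleteLattice (Λᶠ L f) × IsCompleteLattice (Ξᶠ 𝐘 f) ×
    (Σ[ QVarᶠ∈Ξᶠ ∈ (∀ s → IsPAtLogic L f s → IsPAtQuasivariety 𝐘 f (QVarᶠ 𝐘 μ f s)) ]
       IsDualIsomorphism (Λᶠ L f) (Ξᶠ 𝐘 f)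
         (λ (s , s∈Λᶠ) → QVarᶠ 𝐘 μ f s , QVarᶠ∈Ξᶠ s s∈Λᶠ))
corollary3p27 {ℓ} em 𝓛 L 𝐘 μ Δ alg f _ idem =
  Λᶠ-complete , dual-complete (Λᶠ L f) (Ξᶠ 𝐘 f) Q Q-iso Λᶠ-complete , QVarᶠ∈Ξᶠ , Q-iso
  where
  em₀ : ExcludedMiddle ℓ
  em₀ = lower-em (lsuc (lsuc ℓ)) em

  em₁ : ExcludedMiddle (lsuc ℓ)
  em₁ = lower-em (lsuc (lsuc ℓ)) em

  Λᶠ-complete : IsCompleteLattice (Λᶠ L f)
  Λᶠ-complete = complete-by-infima {c = lsuc (lsuc ℓ)} (Λᶠ L f) (Λᶠ-infima em L f)

  QVarᶠ∈Ξᶠ : ∀ s → IsPAtLogic L f s → IsPAtQuasivariety 𝐘 f (QVarᶠ 𝐘 μ f s)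
  QVarᶠ∈Ξᶠ s (T , _ , s⇔Tᶠ) = Models 𝐘 μ T , proj₁ , QVarᶠ-Models em₀ 𝐘 μ f idem T s⇔Tᶠ

  Q : ∃ (IsPAtLogic L f) → ∃ (IsPAtQuasivariety 𝐘 f)
  Q (s , s∈Λᶠ) = QVarᶠ 𝐘 μ f s , QVarᶠ∈Ξᶠ s s∈Λᶠ

  antitone : ∀ {s t : Consequence 𝓛} → s ⇒ t → QVarᶠ 𝐘 μ f t ⊆ QVarᶠ 𝐘 μ f s
  antitone s⇒t (𝒜∈𝐘 , 𝒜⊨t) = 𝒜∈𝐘 , λ Γsφ → 𝒜⊨t (s⇒t Γsφ)

  reflects : ∀ {x y : ∃ (IsPAtLogic L f)} →
             QVarᶠ 𝐘 μ f (proj₁ y) ⊆ QVarᶠ 𝐘 μ f (proj₁ x) → proj₁ x ⇒ proj₁ y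
  reflects {x} {y} = QVarᶠ-reflects em₁ alg f idem (proj₂ y)

  preimage : ∀ 𝐂 → IsPAtQuasivariety 𝐘 f 𝐂 →
             ∃ λ (x : ∃ (IsPAtLogic L f)) → QVarᶠ 𝐘 μ f (proj₁ x) ≐ 𝐂
  preimage 𝐂 (𝐊 , 𝐊⊆𝐘 , 𝐂⊆𝐊↑ , 𝐊↑⊆𝐂) =
    ((f ᶠ) (⊢-of T) , T , logicOf-extends em₁ alg 𝐊 𝐊⊆𝐘 , id , id) ,
    (λ 𝒜∈Q → 𝐊↑⊆𝐂 (↑-mono (proj₁ M≐𝐊) (proj₁ Q≐M↑ 𝒜∈Q))) ,
    (λ 𝒜∈𝐂 → proj₂ Q≐M↑ (↑-mono (proj₂ M≐𝐊) (𝐂⊆𝐊↑ 𝒜∈𝐂)))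
    where
    T = logicOf em₁ alg 𝐊 𝐊⊆𝐘
    M≐𝐊 = Models-logicOf em₁ alg 𝐊 𝐊⊆𝐘
    Q≐M↑ = QVarᶠ-Models em₀ 𝐘 μ f idem T {(f ᶠ) (⊢-of T)} (id , id)

    ↑-mono : ∀ {𝐃 𝐄 : Class 𝓛} → 𝐃 ⊆ 𝐄 → _↑ 𝐘 f 𝐃 ⊆ _↑ 𝐘 f 𝐄
    ↑-mono 𝐃⊆𝐄 (𝒜∈𝐘 , ℬ , ℬ∈𝐃 , ℬ≼𝒜) = 𝒜∈𝐘 , ℬ , 𝐃⊆𝐄 ℬ∈𝐃 , ℬ≼𝒜

  Q-iso : IsDualIsomorphism (Λᶠ L f) (Ξᶠ 𝐘 f) Q
  Q-iso = record
    { isOrderMonomorphism = record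
      { isOrderHomomorphism = record
        { cong = λ (s⇒t , t⇒s) → antitone t⇒s , antitone s⇒t
        ; mono = antitone
        }
      ; injective = λ {x} {y} (Qx⊆Qy , Qy⊆Qx) → reflects {x} {y} Qy⊆Qx , reflects {y} {x} Qx⊆Qy
      ; cancel    = λ {x} {y} → reflects {x} {y}
      }
    ; surjective = λ (𝐂 , 𝐂∈Ξᶠ) →
        let x , Qx⊆𝐂 , 𝐂⊆Qx = preimage 𝐂 𝐂∈Ξᶠ in
        x , λ (z⇒x , x⇒z) → (λ 𝒜∈Qz → Qx⊆𝐂 (antitone x⇒z 𝒜∈Qz)) ,
                            (λ 𝒜∈𝐂 → antitone z⇒x (𝐂⊆Qx 𝒜∈𝐂))
    }
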